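{- For any $m\ge2$, the algorithm ALG($1.75$) (the algorithm ALG($c$) of the context with $c=1.75$) is $1.75$-competitive and uses at most $2.5m$ job migrations on every job sequence.
   Context: Problem: jobs $J_1,\dots,J_n$ with processing times $p_i>0$ arrive online and must be assigned non-preemptively and immediately to one of $m$ identical machines $M_1,\dots,M_m$; a migration removes an assigned job and reassigns it. Makespan = maximum machine load in the final schedule; an algorithm is $c$-competitive if its makespan is at most $c$ times the optimum offline makespan on every sequence. Notation: $p_t^+=\sum_{i\le t}p_i$; $p_t^i$ = $i$-th largest processing time among $J_1,\dots,J_t$ ($0$ if $i>t$). $L_t=\max\{p_t^+/m,\ p_t^1,\ 2p_t^{m+1}\}$. Job $J_i$, $i\le t$, is small at time $t$ if $p_i\le(2c-3)L_t$; $J_t$ is small if small at time $t$, large otherwise. $\ell(j,t)$ = load of $M_j$ just before $J_t$ is assigned; $\ell_s(j,t)$ = same load counting only jobs small at time $t$. $A=\{M_1,\dots,M_{\lfloor m/2\rfloor}\}$, $B=\{M_{\lfloor m/2\rfloor+1},\dots,M_m\}$. Algorithm ALG($c$). Arrival phase: if $J_t$ is small, let $A'=\{M_j\in A:\ell_s(j,t)\le(c-1)L_t\}$; if $A'\ne\emptyset$ assign $J_t$ to a machine of $A'$ with smallest $\ell_s(j,t)$, otherwise to a least loaded machine of $B$. If $J_t$ is large: if some $M_j\in A$ has $\ell(j,t)\le(3-c)L_t$, assign $J_t$ to a least loaded machine of $A$, otherwise to a least loaded machine of $B$. Let $L=L_n$. Migration phase ($\ell(j)$ = current load): removal: $R=\emptyset$;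 from every machine of $B$ remove its largest job into $R$; while some $M_j\in A$ has $\ell(j)>(c-1)L$, remove its largest job into $R$. Reassignment: sort $R$ by non-increasing processing time; for each job $J$ in this order, if some $M_j\in B$ has $\ell(j)+p(J)\le cL$ assign $J$ there, otherwise to a least loaded machine of $A$. Each job of $R$ counts as one migration.
   Formalization: The job processing times are taken to be positive rational numbers instead of positive real numbers. -}

module Defs where

open import Data.Bool using (Bool; true; false; if_then_else_; _∧_; not)
open import Data.Nat as ℕ using (ℕ; zero; suc)
open import Data.Fin as Fin using (Fin; toℕ)
open import Data.Maybe using (Maybe; just; nothing)
open import Data.List using (List; []; _∷_; map; filterᵇ; allFin)
open import Data.Integer using (+_)
open import Data.Rational using (ℚ; 0ℚ; _+_; _*_; _-_; _⊔_; _≤_; _<_; _≤ᵇ_; _/_)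
open import Data.Product using (Σ; _×_)
open import Data.Sum using (_⊎_)
open import Data.Empty using (⊥)
open import Relation.Nullary using (¬_; Dec; yes; no; ⌊_⌋)
open import Relation.Binary.PropositionalEquality using (_≡_)

sumℚ : List ℚ → ℚ
sumℚ []       = 0ℚ
sumℚ (x ∷ xs) = x + sumℚ xs

insertDesc : ℚ → List ℚ → List ℚ
insertDesc x []       = x ∷ []
insertDesc x (y ∷ ys) = if y ≤ᵇ x then x ∷ y ∷ ys else y ∷ insertDesc x ys

sortDesc : List ℚ → List ℚ
sortDesc []       = []
sortDesc (x ∷ xs) = insertDesc x (sortDesc xs)

nthOr0 : ℕ → List ℚ → ℚ
nthOr0 _       []       = 0ℚ
nthOr0 zero    (x ∷ _)  = x
nthOr0 (suc k) (_ ∷ xs) = nthOr0 k xs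

-- (k+1)-th largest value of a list (0 if the list has at most k elements)
largest : ℕ → List ℚ → ℚ
largest k xs = nthOr0 k (sortDesc xs)

-- x / m for a natural number m (m ≥ 2 in the theorem; value at 0 irrelevant)
divℕ : ℚ → ℕ → ℚ
divℕ x zero    = 0ℚ
divℕ x (suc k) = x * (+ 1 / suc k)

fromℕℚ : ℕ → ℚ
fromℕℚ k = + k / 1

sameMachine : {m : ℕ} → Fin m → Fin m → Bool
sameMachine i j = ⌊ i Fin.≟ j ⌋

-- Instance: m machines, n jobs with processing times p (job i = J_{i+1})

module _ (m n : ℕ) (p : Fin n → ℚ) where

  loadWhere : (Fin n → Bool) → ℚ
  loadWhere P = sumℚ (map p (filterᵇ P (allFin n)))

  firstK : ℕ → List ℚ
  firstK k = map p (filterᵇ (λ i → toℕ i ℕ.<ᵇ k) (allFin n))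

  pPlus : ℕ → ℚ
  pPlus k = sumℚ (firstK k)

  Lb : ℕ → ℚ
  Lb k = divℕ (pPlus k) m ⊔ largest 0 (firstK k) ⊔ (fromℕℚ 2 * largest m (firstK k))

  InA : Fin m → Set
  InA j = toℕ j ℕ.< m ℕ./ 2

  InB : Fin m → Set
  InB j = ¬ InA j

  -- (partial) schedules: each job is on some machine or not (yet) assigned
  State : Set
  State = Fin n → Maybe (Fin m)

  onMachine : State → Fin m → Fin n → Bool
  onMachine s j i with s i
  ... | nothing = false
  ... | just k  = sameMachine k j

  load : State → Fin m → ℚ
  load s j = loadWhere (onMachine s j)

  makespan : (Fin n → Fin m) → ℚ
  makespan σ = go (allFin m)
    where
    go : List (Fin m) → ℚ
    go []       = 0ℚ
    go (j ∷ js) = loadWhere (λ i → sameMachine (σ i) j) ⊔ go js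

  module ALG (c : ℚ) where

    -- L_t for job t (0-based index, so it is L_{toℕ t + 1} in paper notation)
    Lt : Fin n → ℚ
    Lt t = Lb (suc (toℕ t))

    smallAtᵇ : Fin n → Fin n → Bool
    smallAtᵇ t i = p i ≤ᵇ ((fromℕℚ 2 * c - fromℕℚ 3) * Lt t)

    SmallJob : Fin n → Set
    SmallJob t = p t ≤ (fromℕℚ 2 * c - fromℕℚ 3) * Lt t

    -- arrival phase; `choice i` is the machine job i is assigned to on arrival
    module Arrival (choice : Fin n → Fin m) where

      ℓ : Fin m → Fin n → ℚ
      ℓ j t = loadWhere (λ i → (toℕ i ℕ.<ᵇ toℕ t) ∧ sameMachine (choice i) j)

      ℓs : Fin m → Fin n → ℚ
      ℓs j t = loadWhere (λ i → (toℕ i ℕ.<ᵇ toℕ t) ∧ sameMachine (choice i) j ∧ smallAtᵇ t i)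

      InA' : Fin n → Fin m → Set
      InA' t j = InA j × ℓs j t ≤ (c - 1ℚ') * Lt t
        where 1ℚ' = fromℕℚ 1

      LeastInB : Fin n → Fin m → Set
      LeastInB t j = InB j × (∀ b → InB b → ℓ j t ≤ ℓ b t)

      -- the assignment rule for J_t (any tie-breaking allowed)
      data ArrivalOK (t : Fin n) : Set where
        small-A : SmallJob t →
                  InA' t (choice t) →
                  (∀ a → InA' t a → ℓs (choice t) t ≤ ℓs a t) →
                  ArrivalOK t
        small-B : SmallJob t →
                  (¬ Σ (Fin m) (InA' t)) →
                  LeastInB t (choice t) →
                  ArrivalOK t
        large-A : ¬ SmallJob t →
                  Σ (Fin m) (λ a → InA a × ℓ a t ≤ (fromℕℚ 3 - c) * Lt t) →
                  InA (choice t) →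
                  (∀ a → InA a → ℓ (choice t) t ≤ ℓ a t) →
                  ArrivalOK t
        large-B : ¬ SmallJob t →
                  (¬ Σ (Fin m) (λ a → InA a × ℓ a t ≤ (fromℕℚ 3 - c) * Lt t)) →
                  LeastInB t (choice t) →
                  ArrivalOK t

      arrivalSchedule : State
      arrivalSchedule i = just (choice i)

    L : ℚ
    L = Lb n

    unassign : State → Fin n → State
    unassign s i k with i Fin.≟ k
    ... | yes _ = nothing
    ... | no  _ = s k

    assign : State → Fin n → Fin m → State
    assign s i j k with i Fin.≟ k
    ... | yes _ = just j
    ... | no  _ = s k

    RemoveLargest : State → Fin m → Fin n → State → Set
    RemoveLargest s j i s' =
      (s i ≡ just j) × (∀ k → s k ≡ just j → p k ≤ p i) × (s' ≡ unassign s i)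

    NonEmpty : State → Fin m → Set
    NonEmpty s j = Σ (Fin n) (λ i → s i ≡ just j)

    -- removal from B: the largest job of every machine of B (machines visited in
    -- the given list order; the visiting order is irrelevant). R collects removed jobs.
    data RemoveB : State → List (Fin m) → List (Fin n) → State → Set where
      done   : ∀ {s} → RemoveB s [] [] s
      skipA  : ∀ {s j js R s'} → InA j → RemoveB s js R s' → RemoveB s (j ∷ js) R s'
      skipE  : ∀ {s j js R s'} → InB j → ¬ NonEmpty s j →
               RemoveB s js R s' → RemoveB s (j ∷ js) R s'
      remove : ∀ {s j js i s₁ R s'} → InB j → RemoveLargest s j i s₁ →
               RemoveB s₁ js R s' → RemoveB s (j ∷ js) (i ∷ R) s'

    data RemoveA : State → List (Fin n) → State → Set where
      stop : ∀ {s} → (∀ j → InA j → load s j ≤ (c - fromℕℚ 1) * L) → RemoveA s [] s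
      step : ∀ {s j i s₁ R s'} → InA j → (c - fromℕℚ 1) * L < load s j →
             RemoveLargest s j i s₁ → RemoveA s₁ R s' → RemoveA s (i ∷ R) s'

    ReassignOK : State → Fin n → Fin m → Set
    ReassignOK s i j =
      (InB j × load s j + p i ≤ c * L)
      ⊎ ((∀ b → InB b → ¬ (load s b + p i ≤ c * L)) × InA j × (∀ a → InA a → load s j ≤ load s a))

    data Reassign : State → List (Fin n) → State → Set where
      done : ∀ {s} → Reassign s [] s
      next : ∀ {s i j Rs s'} → ReassignOK s i j →
             Reassign (assign s i j) Rs s' → Reassign s (i ∷ Rs) s'

module Submission where

-- Write L for the final lower bound L_n; L ≤ OPT, so it suffices to keep every machine at 7/4 L.
-- * Averaging: pairing machines of A with machines of B, loads α on A and β on B with α + β ≥ 2 L_t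
--   are impossible once a further job has to be placed. Hence a job sent to B finds load at most
--   5/4 L_t there (small job; A is then filled with small jobs) or 3/4 L_t (large job).
-- * Migrations: at most one job leaves each machine of B. On a machine of A, deleting the best four
--   jobs always leaves at most 3/4 L_t. This is propagated through the arrivals together with weaker
--   bounds for two and three deletions, relative to the current load: a large arrival multiplies the
--   load by at least 7/5, and at a small arrival at most three jobs on the machine are large.
-- * Reassignment: if a job of size x fits neither on B nor on a machine of A with load at most 3/4 L,
--   then all of B is above 7/4 L - x. For x ≤ L/2 averaging is contradicted. For x > L/2 every machine
--   of A has received a job of size at least x. If some machine of B has not, its load was built up
--   while A was full of small jobs, so A keeps more than L/4 besides the received jobs, and averaging
--   is contradicted again. Otherwise there are more than m jobs of size exceeding L/2.

open import Defs

module _ where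
  open import Algebra.Bundles using (CommutativeMonoid)
  open import Data.Bool using (Bool; true; false; if_then_else_; _∧_; not; T; T?)
  open import Data.Bool.Properties using (∧-assoc)
  open import Data.Empty using (⊥; ⊥-elim)
  open import Data.Fin as Fin using (Fin; zero; suc; toℕ)
  open import Data.Fin.Patterns
  import Data.Fin.Properties as Fin
  open import Data.Integer as ℤ using (+_)
  import Data.Integer.Properties as ℤ
  import Data.List as List
  open import Data.List using (List; []; _∷_; _++_; map; filterᵇ; allFin; length)
  open import Data.List.Membership.Propositional using (_∈_)
  open import Data.List.Membership.Propositional.Properties
    using (∈-++⁻; ∈-∃++; ∈-filter⁺; ∈-allFin; ∈-map⁺)
  open import Data.List.Properties using (map-id; map-∘; map-tabulate; length-++)
  open import Data.List.Relation.Binary.Permutation.Propositional renaming (trans to ↭-step)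
  open import Data.List.Relation.Binary.Permutation.Propositional.Properties
    using (All-resp-↭; ¬x∷xs↭[]; map⁺; shift; ∈-resp-↭; drop-∷; ++⁺ˡ; ++⁺ʳ; ↭-length; filter-↭)
  open import Data.List.Relation.Binary.Permutation.Setoid.Properties using (Unique-resp-↭)
  open import Data.List.Relation.Unary.All as All using (All; []; _∷_)
  import Data.List.Relation.Unary.All.Properties as All
  open import Data.List.Relation.Unary.AllPairs using (AllPairs; []; _∷_)
  open import Data.List.Relation.Unary.Any using (here; there)
  open import Data.List.Relation.Unary.Linked using (Linked)
  open import Data.List.Relation.Unary.Linked.Properties using (Linked⇒AllPairs)
  open import Data.List.Relation.Unary.Unique.Propositional using (Unique)
  import Data.List.Relation.Unary.Unique.Propositional.Properties as Unique
  open import Data.Maybe using (just; nothing; fromMaybe)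
  open import Data.Nat as ℕ using (ℕ; zero; suc)
  import Data.Nat.DivMod as ℕ
  open import Data.Nat.ListAction using () renaming (sum to sumᴸ)
  import Data.Nat.Properties as ℕ
  open import Data.Nat.Tactic.RingSolver using (solve-∀)
  open import Data.Product using (∃; ∃₂; _×_; _,_; proj₁; proj₂)
  open import Data.Rational
  open import Data.Rational.Properties
  import Data.Rational.Unnormalised as ℚᵘ
  import Data.Rational.Unnormalised.Properties as ℚᵘ
  open import Data.Sum using (_⊎_; inj₁; inj₂; [_,_]′) renaming (map to ⊎-map)
  open import Data.Unit using (tt)
  open import Data.Vec as Vec using (Vec; []; _∷_; lookup; zipWith; replicate)
  open import Data.Vec.Functional using (updateAt)
  open import Data.Vec.Functional.Properties using (updateAt-updates; updateAt-minimal)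
  open import Function using (_∘_; id; case_of_)
  open import Level using (0ℓ)
  open import Relation.Binary.PropositionalEquality
  open import Relation.Nullary using (¬_; yes; no; contradiction)
  open import Algebra.Definitions.RawMonoid +-0-rawMonoid using () renaming (_×_ to _·_)
  open import Algebra.Definitions.RawMonoid ℕ.+-0-rawMonoid using () renaming (_×_ to _·ℕ_)
  open import Algebra.Properties.CommutativeMonoid.Mult +-0-commutativeMonoid using (×-homo-+; ×-distrib-+)
  open import Algebra.Properties.CommutativeMonoid.Sum +-0-commutativeMonoid
    using (sum; sum-replicate; sum-cong-≗; ∑-distrib-+)
  open import Algebra.Properties.CommutativeMonoid.Sum ℕ.+-0-commutativeMonoid using () renaming (sum to sumℕ)
  open import Algebra.Properties.CommutativeSemigroup (CommutativeMonoid.commutativeSemigroup +-0-commutativeMonoid)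
    using (interchange)

  -- Certificates for linear inequalities over the rationals.

  -- Linear expressions in n rational variables: a linear consequence is certified by a nonnegative
  -- combination of the hypotheses, and the remaining identity is checked by comparing coefficients.
  data Lin (n : ℕ) : Set where
    var  : Fin n → Lin n
    _:+_ : Lin n → Lin n → Lin n
    _:*_ : ℚ → Lin n → Lin n
    :0   : Lin n

  infixl 6 _:+_
  infixl 7 _:*_

  module _ {n : ℕ} where

    ⟦_⟧ : Lin n → Vec ℚ n → ℚ
    ⟦ var i ⟧  ρ = lookup ρ i
    ⟦ a :+ b ⟧ ρ = ⟦ a ⟧ ρ + ⟦ b ⟧ ρ
    ⟦ c :* a ⟧ ρ = c * ⟦ a ⟧ ρ
    ⟦ :0 ⟧     ρ = 0ℚ

  unit : ∀ {n} → Fin n → Vec ℚ n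
  unit {suc n} zero    = 1ℚ ∷ replicate n 0ℚ
  unit {suc n} (suc i) = 0ℚ ∷ unit i

  coeffs : ∀ {n} → Lin n → Vec ℚ n
  coeffs (var i)  = unit i
  coeffs (a :+ b) = zipWith _+_ (coeffs a) (coeffs b)
  coeffs (c :* a) = Vec.map (c *_) (coeffs a)
  coeffs {n} :0   = replicate n 0ℚ

  dot : ∀ {n} → Vec ℚ n → Vec ℚ n → ℚ
  dot []       []       = 0ℚ
  dot (c ∷ cs) (x ∷ xs) = c * x + dot cs xs

  dot-0 : ∀ {n} (ρ : Vec ℚ n) → dot (replicate n 0ℚ) ρ ≡ 0ℚ
  dot-0 []      = refl
  dot-0 (x ∷ ρ) = trans (cong₂ _+_ (*-zeroˡ x) (dot-0 ρ)) (+-identityˡ 0ℚ)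

  dot-unit : ∀ {n} i (ρ : Vec ℚ n) → dot (unit i) ρ ≡ lookup ρ i
  dot-unit zero    (x ∷ ρ) = trans (cong₂ _+_ (*-identityˡ x) (dot-0 ρ)) (+-identityʳ x)
  dot-unit (suc i) (x ∷ ρ) = trans (cong₂ _+_ (*-zeroˡ x) (dot-unit i ρ)) (+-identityˡ _)

  dot-+ : ∀ {n} (a b ρ : Vec ℚ n) → dot (zipWith _+_ a b) ρ ≡ dot a ρ + dot b ρ
  dot-+ []      []      []      = sym (+-identityˡ 0ℚ)
  dot-+ (x ∷ a) (y ∷ b) (z ∷ ρ) =
    trans (cong₂ _+_ (*-distribʳ-+ z x y) (dot-+ a b ρ)) (interchange (x * z) (y * z) _ _)

  dot-* : ∀ {n} c (a ρ : Vec ℚ n) → dot (Vec.map (c *_) a) ρ ≡ c * dot a ρ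
  dot-* c []      []      = sym (*-zeroʳ c)
  dot-* c (x ∷ a) (z ∷ ρ) =
    trans (cong₂ _+_ (*-assoc c x z) (dot-* c a ρ)) (sym (*-distribˡ-+ c _ _))

  coeffs-correct : ∀ {n} (a : Lin n) ρ → dot (coeffs a) ρ ≡ ⟦ a ⟧ ρ
  coeffs-correct (var i)  ρ = dot-unit i ρ
  coeffs-correct (a :+ b) ρ =
    trans (dot-+ (coeffs a) (coeffs b) ρ) (cong₂ _+_ (coeffs-correct a ρ) (coeffs-correct b ρ))
  coeffs-correct (c :* a) ρ = trans (dot-* c (coeffs a) ρ) (cong (c *_) (coeffs-correct a ρ))
  coeffs-correct :0       ρ = dot-0 ρ

  coeffs-≡ : ∀ {n} (a b : Lin n) ρ → coeffs a ≡ coeffs b → ⟦ a ⟧ ρ ≡ ⟦ b ⟧ ρ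
  coeffs-≡ a b ρ eq =
    trans (sym (coeffs-correct a ρ)) (trans (cong (λ v → dot v ρ) eq) (coeffs-correct b ρ))

  +-cancelʳ-≤ : ∀ {a b c d} → a + d ≡ b + c → c ≤ d → a ≤ b
  +-cancelʳ-≤ {a} {b} {c} {d} eq c≤d = case a ≤? b of λ where
      (yes a≤b) → a≤b
      (no  a≰b) → contradiction (sym eq) (<⇒≢ (+-mono-<-≤ (≰⇒> a≰b) c≤d))

  +-cancelʳ-< : ∀ {a b c d} → a + d ≡ b + c → c < d → a < b
  +-cancelʳ-< {a} {b} {c} {d} eq c<d = case a <? b of λ where
      (yes a<b) → a<b
      (no  a≮b) → contradiction (sym eq) (<⇒≢ (+-mono-≤-< (≮⇒≥ a≮b) c<d))

  -- Both sides of the combined inequality are indices, so the coefficient vectors of a certificate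
  -- are closed and their comparison ends in `refl`.
  data Combo {n : ℕ} (ρ : Vec ℚ n) : Lin n → Lin n → Set where
    []  : Combo ρ :0 :0
    add : ∀ c {{_ : NonNegative c}} a b {l r} → ⟦ a ⟧ ρ ≤ ⟦ b ⟧ ρ →
          Combo ρ l r → Combo ρ (c :* a :+ l) (c :* b :+ r)

  combo-≤ : ∀ {n} {ρ : Vec ℚ n} {l r} → Combo ρ l r → ⟦ l ⟧ ρ ≤ ⟦ r ⟧ ρ
  combo-≤ []              = ≤-refl
  combo-≤ (add c _ _ h k) = +-mono-≤ (*-monoˡ-≤-nonNeg c h) (combo-≤ k)

  -- The combination gives l ≤ r, and a + r = b + l turns b - a into r - l.
  linear-≤ : ∀ {n} (ρ : Vec ℚ n) a b {l r} → Combo ρ l r →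
             coeffs (a :+ r) ≡ coeffs (b :+ l) → ⟦ a ⟧ ρ ≤ ⟦ b ⟧ ρ
  linear-≤ ρ a b {l} {r} k eq = +-cancelʳ-≤ (coeffs-≡ (a :+ r) (b :+ l) ρ eq) (combo-≤ k)

  linear-< : ∀ {n} (ρ : Vec ℚ n) a b c {{_ : Positive c}} x y {l r} →
             ⟦ x ⟧ ρ < ⟦ y ⟧ ρ → Combo ρ l r →
             coeffs (a :+ (c :* y :+ r)) ≡ coeffs (b :+ (c :* x :+ l)) → ⟦ a ⟧ ρ < ⟦ b ⟧ ρ
  linear-< ρ a b c x y {l} {r} h k eq =
    +-cancelʳ-< (coeffs-≡ (a :+ (c :* y :+ r)) (b :+ (c :* x :+ l)) ρ eq)
                (+-mono-<-≤ (*-monoʳ-<-pos c h) (combo-≤ k))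

  -- Boolean comparisons, equality of machines and filtered lists.

  <⇒≱ : ∀ {x y} → x < y → ¬ y ≤ x
  <⇒≱ x<y y≤x = <-irrefl refl (<-≤-trans x<y y≤x)

  ≤ᵇ-true : ∀ {x y} → x ≤ y → (x ≤ᵇ y) ≡ true
  ≤ᵇ-true {x} {y} h with x ≤ᵇ y | ≤⇒≤ᵇ h
  ... | true | _ = refl

  true-≤ᵇ : ∀ {x y} → (x ≤ᵇ y) ≡ true → x ≤ y
  true-≤ᵇ eq = ≤ᵇ⇒≤ (subst T (sym eq) tt)

  ≤ᵇ-false : ∀ {x y} → y < x → (x ≤ᵇ y) ≡ false
  ≤ᵇ-false {x} {y} h with x ≤ᵇ y in eq
  ... | true  = contradiction (<-≤-trans h (true-≤ᵇ eq)) (<-irrefl refl)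
  ... | false = refl

  false-≤ᵇ : ∀ {x y} → (x ≤ᵇ y) ≡ false → y < x
  false-≤ᵇ {x} {y} eq with x ≤? y
  ... | yes h = contradiction (trans (sym (≤ᵇ-true h)) eq) λ ()
  ... | no ¬h = ≰⇒> ¬h

  <ᵇ-true : ∀ {a b} → a ℕ.< b → (a ℕ.<ᵇ b) ≡ true
  <ᵇ-true {a} {b} h with a ℕ.<ᵇ b | ℕ.<⇒<ᵇ h
  ... | true | _ = refl

  true-<ᵇ : ∀ {a b} → (a ℕ.<ᵇ b) ≡ true → a ℕ.< b
  true-<ᵇ {a} {b} eq = ℕ.<ᵇ⇒< a b (subst T (sym eq) tt)

  <ᵇ-false : ∀ {a b} → ¬ a ℕ.< b → (a ℕ.<ᵇ b) ≡ false
  <ᵇ-false {a} {b} h with a ℕ.<ᵇ b in eq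
  ... | true  = contradiction (true-<ᵇ eq) h
  ... | false = refl

  ∧-true : ∀ {a b} → a ∧ b ≡ true → a ≡ true × b ≡ true
  ∧-true {true} {true} refl = refl , refl

  sameMachine-refl : ∀ {m} (j : Fin m) → sameMachine j j ≡ true
  sameMachine-refl j with j Fin.≟ j
  ... | yes _ = refl
  ... | no ¬h = contradiction refl ¬h

  sameMachine-≡ : ∀ {m} {i j : Fin m} → sameMachine i j ≡ true → i ≡ j
  sameMachine-≡ {i = i} {j} eq with i Fin.≟ j
  ... | yes h = h

  sameMachine-≢ : ∀ {m} {i j : Fin m} → i ≢ j → sameMachine i j ≡ false
  sameMachine-≢ {i = i} {j} h with i Fin.≟ j
  ... | yes e = contradiction e h
  ... | no _  = refl

  module _ {A : Set} where

    filterᵇ-cong : ∀ {P Q : A → Bool} {xs} → All (λ x → P x ≡ Q x) xs → filterᵇ P xs ≡ filterᵇ Q xs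
    filterᵇ-cong []                                  = refl
    filterᵇ-cong {P} {Q} {x ∷ _} (h ∷ hs) with P x | Q x | h
    ... | true  | _ | refl = cong (x ∷_) (filterᵇ-cong hs)
    ... | false | _ | refl = filterᵇ-cong hs

    filterᵇ-true : ∀ {P : A → Bool} → (∀ x → P x ≡ true) → ∀ xs → filterᵇ P xs ≡ xs
    filterᵇ-true h []       = refl
    filterᵇ-true {P} h (x ∷ xs) with P x | h x
    ... | true | _ = cong (x ∷_) (filterᵇ-true h xs)

    filterᵇ-filterᵇ : ∀ (P Q : A → Bool) xs → filterᵇ Q (filterᵇ P xs) ≡ filterᵇ (λ x → P x ∧ Q x) xs
    filterᵇ-filterᵇ P Q []       = refl
    filterᵇ-filterᵇ P Q (x ∷ xs) with P x
    ... | false = filterᵇ-filterᵇ P Q xs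
    ... | true with Q x
    ...   | true  = cong (x ∷_) (filterᵇ-filterᵇ P Q xs)
    ...   | false = filterᵇ-filterᵇ P Q xs

    filterᵇ-map : ∀ {B : Set} (P : B → Bool) (f : A → B) xs →
                  filterᵇ P (map f xs) ≡ map f (filterᵇ (λ x → P (f x)) xs)
    filterᵇ-map P f []       = refl
    filterᵇ-map P f (x ∷ xs) with P (f x)
    ... | true  = cong (f x ∷_) (filterᵇ-map P f xs)
    ... | false = filterᵇ-map P f xs

    -- `i` occurs once and is the only element on which `P` and `Q` differ. Arrival, removal and
    -- reassignment of a job all reduce to such a change.
    filterᵇ-insert : ∀ {P Q : A → Bool} {i xs} → Unique xs → i ∈ xs → P i ≡ false → Q i ≡ true →
                     (∀ k → k ≢ i → Q k ≡ P k) → filterᵇ Q xs ↭ i ∷ filterᵇ P xs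
    filterᵇ-insert {P} {Q} {i} {.i ∷ xs} (u ∷ _) (here refl) pf qt h with P i | Q i | pf | qt
    ... | false | true | _ | _ =
      prep i (↭-reflexive (filterᵇ-cong (All.map (λ ne → h _ (λ e → ne (sym e))) u)))
    filterᵇ-insert {P} {Q} {i} {x ∷ xs} (u ∷ us) (there i∈) pf qt h
      with P x | Q x | h x (All.lookup u i∈) | filterᵇ-insert us i∈ pf qt h
    ... | false | _ | refl | r = r
    ... | true  | _ | refl | r = ↭-trans (prep x r) (swap x i ↭-refl)

    sum-filterᵇ-mono : ∀ {P Q : A → Bool} {w : A → ℚ} {xs} → All (λ x → 0ℚ ≤ w x) xs →
                       (∀ x → P x ≡ true → Q x ≡ true) →
                       sumℚ (map w (filterᵇ P xs)) ≤ sumℚ (map w (filterᵇ Q xs))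
    sum-filterᵇ-mono [] P⊆Q = ≤-refl
    sum-filterᵇ-mono {P} {Q} {w} {x ∷ xs} (0≤w ∷ 0≤ws) P⊆Q
      with P x | Q x | P⊆Q x | sum-filterᵇ-mono {P} {Q} 0≤ws P⊆Q
    ... | false | false | _ | r = r
    ... | false | true  | _ | r = ≤-trans (≤-reflexive (sym (+-identityˡ _))) (+-mono-≤ 0≤w r)
    ... | true  | true  | _ | r = +-monoʳ-≤ (w x) r
    ... | true  | false | h | _ with () ← h refl

    length-filterᵇ-mono : ∀ {P Q : A → Bool} → (∀ x → P x ≡ true → Q x ≡ true) →
                          ∀ xs → length (filterᵇ P xs) ℕ.≤ length (filterᵇ Q xs)
    length-filterᵇ-mono P⊆Q [] = ℕ.z≤n
    length-filterᵇ-mono {P} {Q} P⊆Q (x ∷ xs) with P x | Q x | P⊆Q x | length-filterᵇ-mono {P} {Q} P⊆Q xs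
    ... | false | false | _ | r = r
    ... | false | true  | _ | r = ℕ.m≤n⇒m≤1+n r
    ... | true  | true  | _ | r = ℕ.s≤s r
    ... | true  | false | h | _ with () ← h refl

    filterᵇ-split : ∀ (P : A → Bool) xs → xs ↭ filterᵇ (λ x → not (P x)) xs ++ filterᵇ P xs
    filterᵇ-split P []       = ↭-refl
    filterᵇ-split P (x ∷ xs) with P x
    ... | false = prep x (filterᵇ-split P xs)
    ... | true  = ↭-trans (prep x (filterᵇ-split P xs)) (↭-sym (shift x _ _))

  -- Sums of lists, decreasing order and counting above a threshold.

  sumℚ-↭ : ∀ {xs ys} → xs ↭ ys → sumℚ xs ≡ sumℚ ys
  sumℚ-↭ refl         = refl
  sumℚ-↭ (prep x p)   = cong (_+_ x) (sumℚ-↭ p)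
  sumℚ-↭ {_ ∷ _ ∷ xs} {_ ∷ _ ∷ ys} (swap x y p) = begin
    x + (y + sumℚ xs) ≡⟨ +-assoc x y _ ⟨
    x + y + sumℚ xs   ≡⟨ cong₂ _+_ (+-comm x y) (sumℚ-↭ p) ⟩
    y + x + sumℚ ys   ≡⟨ +-assoc y x _ ⟩
    y + (x + sumℚ ys) ∎
    where open ≡-Reasoning
  sumℚ-↭ (↭-step p q)  = trans (sumℚ-↭ p) (sumℚ-↭ q)

  sumℚ-++ : ∀ xs ys → sumℚ (xs ++ ys) ≡ sumℚ xs + sumℚ ys
  sumℚ-++ []       ys = sym (+-identityˡ _)
  sumℚ-++ (x ∷ xs) ys = trans (cong (_+_ x) (sumℚ-++ xs ys)) (sym (+-assoc x _ _))

  sumℚ-nonneg : ∀ {xs} → All (0ℚ ≤_) xs → 0ℚ ≤ sumℚ xs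
  sumℚ-nonneg []       = ≤-refl
  sumℚ-nonneg (h ∷ hs) = ≤-trans (≤-reflexive (sym (+-identityˡ 0ℚ))) (+-mono-≤ h (sumℚ-nonneg hs))

  Desc : List ℚ → Set
  Desc = AllPairs (λ x y → y ≤ x)

  insertDesc-↭ : ∀ x xs → insertDesc x xs ↭ x ∷ xs
  insertDesc-↭ x []       = ↭-refl
  insertDesc-↭ x (y ∷ ys) with y ≤ᵇ x
  ... | true  = ↭-refl
  ... | false = ↭-trans (prep y (insertDesc-↭ x ys)) (swap y x ↭-refl)

  sortDesc-↭ : ∀ xs → sortDesc xs ↭ xs
  sortDesc-↭ []       = ↭-refl
  sortDesc-↭ (x ∷ xs) = ↭-trans (insertDesc-↭ x (sortDesc xs)) (prep x (sortDesc-↭ xs))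

  insertDesc-Desc : ∀ x {xs} → Desc xs → Desc (insertDesc x xs)
  insertDesc-Desc x {[]}     []       = [] ∷ []
  insertDesc-Desc x {y ∷ ys} (h ∷ hs) with y ≤ᵇ x in eq
  ... | true  = (true-≤ᵇ eq ∷ All.map (λ z≤y → ≤-trans z≤y (true-≤ᵇ eq)) h) ∷ h ∷ hs
  ... | false = All-resp-↭ (↭-sym (insertDesc-↭ x ys)) (<⇒≤ (false-≤ᵇ eq) ∷ h) ∷ insertDesc-Desc x hs

  sortDesc-Desc : ∀ xs → Desc (sortDesc xs)
  sortDesc-Desc []       = []
  sortDesc-Desc (x ∷ xs) = insertDesc-Desc x (sortDesc-Desc xs)

  -- The indicator is rational so that counting jobs is a case of weighing them: `sum-machines` and
  -- `crowded` then apply to counts as well as to loads.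
  above : ℚ → ℚ → ℚ
  above θ x = if x ≤ᵇ θ then 0ℚ else 1ℚ

  count> : ℚ → List ℚ → ℚ
  count> θ xs = sumℚ (map (above θ) xs)

  above-0 : ∀ θ {x} → x ≤ θ → above θ x ≡ 0ℚ
  above-0 θ {x} h rewrite ≤ᵇ-true h = refl

  above-1 : ∀ θ {x} → θ < x → above θ x ≡ 1ℚ
  above-1 θ h rewrite ≤ᵇ-false h = refl

  0≤1 : 0ℚ ≤ 1ℚ
  0≤1 = nonNegative⁻¹ 1ℚ

  0<1 : 0ℚ < 1ℚ
  0<1 = positive⁻¹ 1ℚ

  above-nonneg : ∀ θ x → 0ℚ ≤ above θ x
  above-nonneg θ x with x ≤ᵇ θ
  ... | true  = ≤-refl
  ... | false = 0≤1

  above-≤1 : ∀ θ x → above θ x ≤ 1ℚ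
  above-≤1 θ x with x ≤ᵇ θ
  ... | true  = 0≤1
  ... | false = ≤-refl

  count>-nonneg : ∀ θ xs → 0ℚ ≤ count> θ xs
  count>-nonneg θ []       = ≤-refl
  count>-nonneg θ (x ∷ xs) =
    ≤-trans (≤-reflexive (sym (+-identityˡ 0ℚ))) (+-mono-≤ (above-nonneg θ x) (count>-nonneg θ xs))

  count>-↭ : ∀ θ {xs ys} → xs ↭ ys → count> θ xs ≡ count> θ ys
  count>-↭ θ p = sumℚ-↭ (map⁺ (above θ) p)

  count>-0 : ∀ θ {xs} → All (_≤ θ) xs → count> θ xs ≡ 0ℚ
  count>-0 θ []                 = refl
  count>-0 θ {x ∷ _} (h ∷ hs) =
    trans (cong₂ _+_ (above-0 θ h) (count>-0 θ hs)) (+-identityˡ 0ℚ)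

  ·-nonneg : ∀ k {x} → 0ℚ ≤ x → 0ℚ ≤ k · x
  ·-nonneg zero    h = ≤-refl
  ·-nonneg (suc k) h = ≤-trans (≤-reflexive (sym (+-identityˡ 0ℚ))) (+-mono-≤ h (·-nonneg k h))

  -- In decreasing order the elements above θ form a prefix, and it stops before position k, counted
  -- from 0.
  Desc-count>-≤ : ∀ θ k {xs} → Desc xs → nthOr0 k xs ≤ θ → count> θ xs ≤ k · 1ℚ
  Desc-count>-≤ θ k       {[]}     _        _ = ·-nonneg k 0≤1
  Desc-count>-≤ θ zero    {x ∷ xs} (h ∷ _)  l = ≤-reflexive (count>-0 θ (l ∷ All.map (λ y≤x → ≤-trans y≤x l) h))
  Desc-count>-≤ θ (suc k) {x ∷ xs} (_ ∷ hs) l = +-mono-≤ (above-≤1 θ x) (Desc-count>-≤ θ k hs l)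

  nthOr0-< : ∀ {θ x} k {xs} → 0ℚ ≤ θ → θ < nthOr0 k xs → All (_≤ x) xs → θ < x
  nthOr0-< k       {[]}    0≤θ l _        = contradiction (<-≤-trans l 0≤θ) (<-irrefl refl)
  nthOr0-< zero    {_ ∷ _} 0≤θ l (h ∷ _)  = <-≤-trans l h
  nthOr0-< (suc k) {_ ∷ _} 0≤θ l (_ ∷ hs) = nthOr0-< k 0≤θ l hs

  -- The first k + 1 entries are at least the one at position k. The condition θ ≥ 0 excludes the
  -- default 0 that `nthOr0` returns past the end.
  Desc-count>-≥ : ∀ θ k {xs} → Desc xs → 0ℚ ≤ θ → θ < nthOr0 k xs → suc k · 1ℚ ≤ count> θ xs
  Desc-count>-≥ θ k       {[]}     _        0≤θ l = contradiction (<-≤-trans l 0≤θ) (<-irrefl refl)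
  Desc-count>-≥ θ zero    {x ∷ xs} _        0≤θ l = +-mono-≤ (≤-reflexive (sym (above-1 θ l))) (count>-nonneg θ xs)
  Desc-count>-≥ θ (suc k) {x ∷ xs} (h ∷ hs) 0≤θ l =
    +-mono-≤ (≤-reflexive (sym (above-1 θ (nthOr0-< k 0≤θ l h)))) (Desc-count>-≥ θ k hs 0≤θ l)

  largest-count>-≤ : ∀ θ k xs → largest k xs ≤ θ → count> θ xs ≤ k · 1ℚ
  largest-count>-≤ θ k xs l =
    subst (_≤ k · 1ℚ) (count>-↭ θ (sortDesc-↭ xs)) (Desc-count>-≤ θ k (sortDesc-Desc xs) l)

  largest-count>-≥ : ∀ θ k xs → 0ℚ ≤ θ → θ < largest k xs → suc k · 1ℚ ≤ count> θ xs
  largest-count>-≥ θ k xs 0≤θ l =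
    subst (suc k · 1ℚ ≤_) (count>-↭ θ (sortDesc-↭ xs)) (Desc-count>-≥ θ k (sortDesc-Desc xs) 0≤θ l)

  -- Sums over machines.

  module _ (M : CommutativeMonoid 0ℓ 0ℓ) where
    open CommutativeMonoid M renaming (Carrier to C; refl to ≈-refl; trans to ≈-trans; sym to ≈-sym)
    open import Algebra.Properties.CommutativeMonoid.Sum M using () renaming (sum to sumᴹ)
    open import Algebra.Properties.CommutativeMonoid.Mult M using () renaming (_×_ to _×ᴹ_)

    -- Kept general because it serves twice: in ℚ for averaging loads and in ℕ for counting
    -- migrations.
    sum-threshold : ∀ m h α β → h ℕ.≤ m →
                    sumᴹ {m} (λ j → if toℕ j ℕ.<ᵇ h then α else β) ≈ (h ×ᴹ α) ∙ ((m ℕ.∸ h) ×ᴹ β)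
    sum-threshold zero    zero    α β _         = ≈-sym (identityˡ ε)
    sum-threshold (suc m) zero    α β _         =
      ≈-trans (∙-congˡ (≈-trans (sum-threshold m zero α β ℕ.z≤n) (identityˡ _))) (≈-sym (identityˡ _))
    sum-threshold (suc m) (suc h) α β (ℕ.s≤s l) =
      ≈-trans (∙-congˡ (sum-threshold m h α β l)) (≈-sym (assoc _ _ _))

  sum-mono : ∀ {m} {f g : Fin m → ℚ} → (∀ j → f j ≤ g j) → sum f ≤ sum g
  sum-mono {zero}  h = ≤-refl
  sum-mono {suc m} h = +-mono-≤ (h zero) (sum-mono (λ j → h (suc j)))

  sum-0 : ∀ {m} {f : Fin m → ℚ} → (∀ j → f j ≡ 0ℚ) → sum f ≡ 0ℚ
  sum-0 {zero}  h = refl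
  sum-0 {suc m} h = trans (cong₂ _+_ (h zero) (sum-0 (λ j → h (suc j)))) (+-identityˡ 0ℚ)

  sum-single : ∀ {m} (f : Fin m → ℚ) k → (∀ j → j ≢ k → f j ≡ 0ℚ) → sum f ≡ f k
  sum-single f zero    h =
    trans (cong (_+_ (f zero)) (sum-0 (λ j → h (suc j) λ ()))) (+-identityʳ _)
  sum-single f (suc k) h =
    trans (cong₂ _+_ (h zero λ ()) (sum-single (λ j → f (suc j)) k λ j ne → h (suc j) λ { refl → ne refl }))
          (+-identityˡ _)

  sum-indicator : ∀ {m} (k : Fin m) x → sum (λ j → if sameMachine k j then x else 0ℚ) ≡ x
  sum-indicator k x =
    trans (sum-single _ k (λ j ne → cong (if_then x else 0ℚ) (sameMachine-≢ λ e → ne (sym e))))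
          (cong (if_then x else 0ℚ) (sameMachine-refl k))

  -- Each item is counted on exactly one machine, the one given by σ.
  sum-machines : ∀ {m} {A : Set} (σ : A → Fin m) (w : A → ℚ) xs →
                 sum (λ j → sumℚ (map w (filterᵇ (λ i → sameMachine (σ i) j) xs))) ≡ sumℚ (map w xs)
  sum-machines {m} σ w []   = sum-0 {m} {λ _ → 0ℚ} (λ _ → refl)
  sum-machines {m} σ w (x ∷ xs) = begin
    sum (λ j → sumℚ (map w (filterᵇ (λ i → sameMachine (σ i) j) (x ∷ xs)))) ≡⟨ sum-cong-≗ cons ⟩
    sum (λ j → single j + rest j)                                           ≡⟨ ∑-distrib-+ single rest ⟩
    sum single + sum rest                                                   ≡⟨ cong₂ _+_ (sum-indicator (σ x) (w x)) (sum-machines σ w xs) ⟩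
    w x + sumℚ (map w xs)                                                   ∎
    where
    open ≡-Reasoning
    single rest : Fin m → ℚ
    single j = if sameMachine (σ x) j then w x else 0ℚ
    rest j   = sumℚ (map w (filterᵇ (λ i → sameMachine (σ i) j) xs))

    cons : ∀ j → sumℚ (map w (filterᵇ (λ i → sameMachine (σ i) j) (x ∷ xs))) ≡ single j + rest j
    cons j with sameMachine (σ x) j
    ... | true  = refl
    ... | false = sym (+-identityˡ _)

  ·-mono : ∀ k {x y} → x ≤ y → k · x ≤ k · y
  ·-mono zero    h = ≤-refl
  ·-mono (suc k) h = +-mono-≤ h (·-mono k h)

  -- Averaging over pairs of machines.

  m/2≤m : ∀ m → m ℕ./ 2 ℕ.≤ m
  m/2≤m m = ℕ.m/n≤m m 2

  -- The case of even m, with a, b, l for the h-fold multiples of α, β, L: the pairs use up the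
  -- whole total, and x > 0 is left over.
  even-gap : ∀ a b l x → 0ℚ < x → l + l ≤ a + b → a + b + x ≤ l + l → ⊥
  even-gap a b l x h₁ h₂ h₃ =
    <-irrefl refl (linear-< (a ∷ b ∷ l ∷ x ∷ []) :0 :0 1ℚ :0 (var 3F) h₁
      (add 1ℚ (var 2F :+ var 2F) (var 0F :+ var 1F) h₂
      (add 1ℚ (var 0F :+ var 1F :+ var 3F) (var 2F :+ var 2F) h₃
      [])) refl)

  -- The case of odd m: B has one machine more than A, and this unpaired share β exceeds L together
  -- with x.
  odd-gap : ∀ a b l x β L → L < β + x → l + l ≤ a + b → a + β + b + x ≤ L + l + l → ⊥
  odd-gap a b l x β L h₁ h₂ h₃ =
    <-irrefl refl (linear-< (a ∷ b ∷ l ∷ x ∷ β ∷ L ∷ []) :0 :0 1ℚ (var 5F) (var 4F :+ var 3F) h₁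
      (add 1ℚ (var 2F :+ var 2F) (var 0F :+ var 1F) h₂
      (add 1ℚ (var 0F :+ var 4F :+ var 1F :+ var 3F) (var 5F :+ var 2F :+ var 2F) h₃
      [])) refl)

  -- Pairing the machines of A with those of B, each pair already holds 2L.
  crowded : ∀ {m} {A : Set} (σ : A → Fin m) (w : A → ℚ) xs {α β x L} (j₀ : Fin m) → ¬ toℕ j₀ ℕ.< m ℕ./ 2 →
            0ℚ < x → L < β + x → L + L ≤ α + β →
            let loadOf = λ j → sumℚ (map w (filterᵇ (λ i → sameMachine (σ i) j) xs)) in
            (∀ j → toℕ j ℕ.< m ℕ./ 2 → α ≤ loadOf j) → (∀ j → ¬ toℕ j ℕ.< m ℕ./ 2 → β ≤ loadOf j) →
            β + x ≤ loadOf j₀ → ¬ sumℚ (map w xs) ≤ m · L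
  crowded {m} {A} σ w xs {α} {β} {x} {L} j₀ j₀∈B 0<x L<β+x 2L≤α+β loadA loadB load₀ total =
    parity (m ℕ.% 2) (ℕ.m%n<n m 2) (ℕ.m≡m%n+[m/n]*n m 2)
    where
    h : ℕ
    h = m ℕ./ 2
    loadOf base extra : Fin m → ℚ
    loadOf j  = sumℚ (map w (filterᵇ (λ i → sameMachine (σ i) j) xs))
    base j  = if toℕ j ℕ.<ᵇ h then α else β
    extra j = if sameMachine j₀ j then x else 0ℚ

    below : ∀ j → base j + extra j ≤ loadOf j
    below j with j₀ Fin.≟ j | toℕ j ℕ.<? h
    ... | yes refl | yes j∈A = contradiction j∈A j₀∈B
    ... | yes refl | no j∈B rewrite <ᵇ-false j∈B = load₀
    ... | no _     | yes j∈A rewrite <ᵇ-true j∈A = ≤-trans (≤-reflexive (+-identityʳ α)) (loadA j j∈A)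
    ... | no _     | no j∈B rewrite <ᵇ-false j∈B = ≤-trans (≤-reflexive (+-identityʳ β)) (loadB j j∈B)

    bound : h · α + (m ℕ.∸ h) · β + x ≤ m · L
    bound = begin
      h · α + (m ℕ.∸ h) · β + x     ≡⟨ cong₂ _+_ (sum-threshold +-0-commutativeMonoid m h α β (m/2≤m m)) (sum-indicator j₀ x) ⟨
      sum base + sum extra          ≡⟨ ∑-distrib-+ base extra ⟨
      sum (λ j → base j + extra j)  ≤⟨ sum-mono below ⟩
      sum loadOf                    ≡⟨ sum-machines σ w xs ⟩
      sumℚ (map w xs)               ≤⟨ total ⟩
      m · L                         ∎
      where open ≤-Reasoning

    pairs : h · L + h · L ≤ h · α + h · β
    pairs = begin
      h · L + h · L  ≡⟨ ×-distrib-+ L L h ⟨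
      h · (L + L)    ≤⟨ ·-mono h 2L≤α+β ⟩
      h · (α + β)    ≡⟨ ×-distrib-+ α β h ⟩
      h · α + h · β  ∎
      where open ≤-Reasoning

    parity : ∀ e → e ℕ.< 2 → m ≡ e ℕ.+ h ℕ.* 2 → ⊥
    parity e e<2 m≡ = finish e e<2 (subst₂ (λ a b → h · α + a · β + x ≤ b · L) m∸h≡ m≡′ bound)
      where
      m≡′ : m ≡ e ℕ.+ h ℕ.+ h
      m≡′ = trans m≡ (trans (cong (e ℕ.+_) (trans (ℕ.*-comm h 2) (cong (h ℕ.+_) (ℕ.+-identityʳ h))))
                            (sym (ℕ.+-assoc e h h)))
      -- B consists of e + h machines, where e is the parity of m.
      m∸h≡ : m ℕ.∸ h ≡ e ℕ.+ h
      m∸h≡ = trans (cong (ℕ._∸ h) m≡′) (ℕ.m+n∸n≡m (e ℕ.+ h) h)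
      finish : ∀ e → e ℕ.< 2 → h · α + (e ℕ.+ h) · β + x ≤ (e ℕ.+ h ℕ.+ h) · L → ⊥
      finish 0 _ le = even-gap (h · α) (h · β) (h · L) x 0<x pairs
        (subst (h · α + h · β + x ≤_) (×-homo-+ L h h) le)
      finish 1 _ le = odd-gap (h · α) (h · β) (h · L) x β L L<β+x pairs
        (subst₂ _≤_ (cong (_+ x) (sym (+-assoc (h · α) β (h · β))))
                    (trans (cong (_+_ L) (×-homo-+ L h h)) (sym (+-assoc L (h · L) (h · L)))) le)
      finish (suc (suc e)) (ℕ.s≤s (ℕ.s≤s ())) _

  -- Small and large jobs, and loads after k deletions.

  small large : ℚ → ℚ → Bool
  small θ x = x ≤ᵇ θ
  large θ x = not (x ≤ᵇ θ)

  -- Only the existence of a good choice `ds` is recorded; `Trim-greedy` transfers it to the removal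
  -- of largest jobs.
  Trim : ℕ → List ℚ → ℚ → Set
  Trim k xs b = ∃₂ λ ds ys → xs ↭ ds ++ ys × length ds ℕ.≤ k × sumℚ ys ≤ b

  Trim-↭ : ∀ {k xs xs′ b} → xs ↭ xs′ → Trim k xs b → Trim k xs′ b
  Trim-↭ p (ds , ys , q , k , s) = ds , ys , ↭-trans (↭-sym p) q , k , s

  Trim-mono : ∀ {k k′ xs b b′} → k ℕ.≤ k′ → b ≤ b′ → Trim k xs b → Trim k′ xs b′
  Trim-mono k≤ b≤ (ds , ys , q , k , s) = ds , ys , q , ℕ.≤-trans k k≤ , ≤-trans s b≤

  Trim-none : ∀ {k xs b} → sumℚ xs ≤ b → Trim k xs b
  Trim-none s = [] , _ , ↭-refl , ℕ.z≤n , s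

  Trim-drop : ∀ {k xs b} x → Trim k xs b → Trim (suc k) (x ∷ xs) b
  Trim-drop x (ds , ys , q , k , s) = x ∷ ds , ys , prep x q , ℕ.s≤s k , s

  Trim-keep : ∀ {k xs b} x → Trim k xs b → Trim k (x ∷ xs) (x + b)
  Trim-keep x (ds , ys , q , k , s) =
    ds , x ∷ ys , ↭-trans (prep x q) (↭-sym (shift x ds ys)) , k , +-monoʳ-≤ x s

  Trim-filterᵇ : ∀ P xs → Trim (length (filterᵇ (λ x → not (P x)) xs)) xs (sumℚ (filterᵇ P xs))
  Trim-filterᵇ P xs =
    filterᵇ (λ x → not (P x)) xs , filterᵇ P xs , filterᵇ-split P xs , ℕ.≤-refl , ≤-refl

  large-drop : ∀ x s b θ k → θ < x → b + k ≤ s → b + θ + k ≤ x + s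
  large-drop x s b θ k h₁ h₂ =
    linear-≤ (x ∷ s ∷ b ∷ θ ∷ k ∷ []) (var 2F :+ var 3F :+ var 4F) (var 0F :+ var 1F)
      (add 1ℚ (var 3F) (var 0F) (<⇒≤ h₁)
      (add 1ℚ (var 2F :+ var 4F) (var 1F) h₂
      [])) refl

  small-keep : ∀ x s b k → b + k ≤ s → x + b + k ≤ x + s
  small-keep x s b k h₁ =
    linear-≤ (x ∷ s ∷ b ∷ k ∷ []) (var 0F :+ var 2F :+ var 3F) (var 0F :+ var 1F)
      (add 1ℚ (var 2F :+ var 3F) (var 1F) h₁
      []) refl

  -- Each of the k deleted elements is above θ, so the sum falls by at least k θ; b is what remains.
  Trim-large : ∀ θ k xs → All (0ℚ ≤_) xs → k ℕ.≤ length (filterᵇ (large θ) xs) →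
               ∃ λ b → 0ℚ ≤ b × b + k · θ ≤ sumℚ xs × Trim k xs b
  Trim-large θ zero    xs       0≤xs       _  =
    sumℚ xs , sumℚ-nonneg 0≤xs , ≤-reflexive (+-identityʳ _) , Trim-none ≤-refl
  Trim-large θ (suc k) (x ∷ xs) (0≤x ∷ 0≤xs) le with x ≤ᵇ θ in eq
  ... | true  with Trim-large θ (suc k) xs 0≤xs le
  ...   | b , 0≤b , l , t =
    x + b , ≤-trans (≤-reflexive (sym (+-identityˡ 0ℚ))) (+-mono-≤ 0≤x 0≤b) ,
    small-keep x (sumℚ xs) b (suc k · θ) l , Trim-keep x t
  Trim-large θ (suc k) (x ∷ xs) (0≤x ∷ 0≤xs) le | false with Trim-large θ k xs 0≤xs (ℕ.s≤s⁻¹ le)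
  ...   | b , 0≤b , l , t =
    b , 0≤b , subst (_≤ x + sumℚ xs) (+-assoc b θ _) (large-drop x (sumℚ xs) b θ (k · θ) (false-≤ᵇ {x} {θ} eq) l) ,
    Trim-drop x t

  filterᵇ-nonneg : ∀ (P : ℚ → Bool) {xs} → All (0ℚ ≤_) xs → All (0ℚ ≤_) (filterᵇ P xs)
  filterᵇ-nonneg P = All.filter⁺ (T? ∘ P)

  sum-small-large : ∀ θ xs → sumℚ xs ≡ sumℚ (filterᵇ (large θ) xs) + sumℚ (filterᵇ (small θ) xs)
  sum-small-large θ xs = trans (sumℚ-↭ (filterᵇ-split (small θ) xs)) (sumℚ-++ (filterᵇ (large θ) xs) _)

  sum-filterᵇ-id-mono : ∀ {P Q : ℚ → Bool} {xs} → All (0ℚ ≤_) xs → (∀ x → P x ≡ true → Q x ≡ true) →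
                        sumℚ (filterᵇ P xs) ≤ sumℚ (filterᵇ Q xs)
  sum-filterᵇ-id-mono {P} {Q} {xs} 0≤xs h =
    subst₂ _≤_ (cong sumℚ (map-id (filterᵇ P xs))) (cong sumℚ (map-id (filterᵇ Q xs))) (sum-filterᵇ-mono {P = P} {Q} {id} 0≤xs h)

  small-mono : ∀ {θ θ′} → θ ≤ θ′ → ∀ x → small θ x ≡ true → small θ′ x ≡ true
  small-mono {θ} {θ′} h x eq = ≤ᵇ-true {x} {θ′} (≤-trans (true-≤ᵇ {x} {θ} eq) h)

  large-mono : ∀ {θ θ′} → θ ≤ θ′ → ∀ x → large θ′ x ≡ true → large θ x ≡ true
  large-mono {θ} {θ′} h x eq with x ≤ᵇ θ in e
  ... | false = refl
  ... | true  = trans (sym (cong not (small-mono {θ} {θ′} h x e))) eq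

  -- The invariant for the machines of A.

  -- The fractions 4/5 and 3/5 fit together: a large arrival multiplies the load by at least 7/5,
  -- 4/5 ≤ 7/5 · 3/5, and a large job is only accepted at load at most 5/4 L = 5/3 · 3/4 L.
  record Balanced (L : ℚ) (xs : List ℚ) : Set where
    constructor balanced
    field
      nonneg : All (0ℚ ≤_) xs
      few    : length (filterᵇ (large (½ * L)) xs) ℕ.≤ 3
      heavy  : sumℚ (filterᵇ (large (½ * L)) xs) ≤ (+ 9 / 4) * L
      trim₂  : Trim 2 xs ((+ 4 / 5) * sumℚ xs) ⊎ Trim 2 xs ((+ 3 / 4) * L)
      trim₃  : Trim 3 xs ((+ 3 / 5) * sumℚ xs) ⊎ Trim 3 xs ((+ 3 / 4) * L)
      trim₄  : Trim 4 xs ((+ 3 / 4) * L)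

  Balanced-[] : ∀ L → 0ℚ ≤ L → Balanced L []
  Balanced-[] L 0≤L = balanced [] ℕ.z≤n (scale (+ 9 / 4)) (inj₂ none) (inj₂ none) none
    where
    scale : ∀ c {{_ : NonNegative c}} → 0ℚ ≤ c * L
    scale c = subst (_≤ c * L) (*-zeroʳ c) (*-monoˡ-≤-nonNeg c 0≤L)
    none : ∀ {k} → Trim k [] ((+ 3 / 4) * L)
    none = Trim-none (scale (+ 3 / 4))

  Balanced-mono : ∀ L L′ {xs} → L ≤ L′ → Balanced L xs → Balanced L′ xs
  Balanced-mono L L′ {xs} L≤L′ (balanced nn f h t₂ t₃ t₄) = balanced nn
    (ℕ.≤-trans (length-filterᵇ-mono (large-mono ½L≤½L′) xs) f)
    (≤-trans (sum-filterᵇ-id-mono nn (large-mono ½L≤½L′)) (≤-trans h (scale (+ 9 / 4))))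
    (⊎-map id grow t₂) (⊎-map id grow t₃) (grow t₄)
    where
    scale : ∀ c {{_ : NonNegative c}} → c * L ≤ c * L′
    scale c = *-monoˡ-≤-nonNeg c L≤L′
    ½L≤½L′ = scale ½
    grow : ∀ {k} → Trim k xs ((+ 3 / 4) * L) → Trim k xs ((+ 3 / 4) * L′)
    grow = Trim-mono ℕ.≤-refl (scale (+ 3 / 4))

  Balanced-↭ : ∀ L {xs ys} → xs ↭ ys → Balanced L xs → Balanced L ys
  Balanced-↭ L {xs} {ys} p (balanced nn f h t₂ t₃ t₄) = balanced
    (All-resp-↭ p nn)
    (subst (ℕ._≤ 3) (↭-length p′) f)
    (subst (_≤ (+ 9 / 4) * L) (sumℚ-↭ p′) h)
    (⊎-map (λ t → subst (λ s → Trim 2 ys ((+ 4 / 5) * s)) (sumℚ-↭ p) (Trim-↭ p t)) (Trim-↭ p) t₂)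
    (⊎-map (λ t → subst (λ s → Trim 3 ys ((+ 3 / 5) * s)) (sumℚ-↭ p) (Trim-↭ p t)) (Trim-↭ p) t₃)
    (Trim-↭ p t₄)
    where p′ = filter-↭ (T? ∘ large (½ * L)) p

  Trim-large₂ : ∀ L xs → All (0ℚ ≤_) xs → 2 ℕ.≤ length (filterᵇ (large (½ * L)) xs) →
                ∃ λ b → 0ℚ ≤ b × b + L ≤ sumℚ xs × Trim 2 xs b
  Trim-large₂ L xs 0≤xs le with Trim-large (½ * L) 2 xs 0≤xs le
  ... | b , 0≤b , l , t = b , 0≤b , subst (λ y → b + y ≤ sumℚ xs)
    (coeffs-≡ (½ :* var 0F :+ (½ :* var 0F :+ :0)) (var 0F) (L ∷ []) refl) l , t

  Trim-large₃ : ∀ L xs → All (0ℚ ≤_) xs → 3 ℕ.≤ length (filterᵇ (large (½ * L)) xs) →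
                ∃ λ b → 0ℚ ≤ b × b + (+ 3 / 2) * L ≤ sumℚ xs × Trim 3 xs b
  Trim-large₃ L xs 0≤xs le with Trim-large (½ * L) 3 xs 0≤xs le
  ... | b , 0≤b , l , t = b , 0≤b , subst (λ y → b + y ≤ sumℚ xs)
    (coeffs-≡ (½ :* var 0F :+ (½ :* var 0F :+ (½ :* var 0F :+ :0))) ((+ 3 / 2) :* var 0F) (L ∷ []) refl) l , t

  -- Three large jobs weigh at least 3/2 L, beyond the load 5/4 L up to which a further large job is
  -- accepted. The bounds on x supply L > 0.
  three-large : ∀ L x s b → ½ * L < x → x ≤ L → 0ℚ ≤ b → b + (+ 3 / 2) * L ≤ s → s ≤ (+ 5 / 4) * L → ⊥
  three-large L x s b h₁ h₂ h₃ h₄ h₅ =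
    <-irrefl refl (linear-< (L ∷ x ∷ s ∷ b ∷ []) :0 :0 1ℚ (½ :* var 0F) (var 1F) h₁
      (add 1ℚ (var 1F) (var 0F) h₂
      (add (+ 2 / 1) :0 (var 3F) h₃
      (add (+ 2 / 1) (var 3F :+ (+ 3 / 2) :* var 0F) (var 2F) h₄
      (add (+ 2 / 1) (var 2F) ((+ 5 / 4) :* var 0F) h₅
      [])))) refl)

  -- At most 5/4 L is present when a large job is accepted, and that job adds at most L.
  heavy-large : ∀ L x s l → x ≤ L → s ≤ (+ 5 / 4) * L → l ≤ s → x + l ≤ (+ 9 / 4) * L
  heavy-large L x s l h₁ h₂ h₃ =
    linear-≤ (L ∷ x ∷ s ∷ l ∷ []) (var 1F :+ var 3F) ((+ 9 / 4) :* var 0F)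
      (add 1ℚ (var 1F) (var 0F) h₁
      (add 1ℚ (var 2F) ((+ 5 / 4) :* var 0F) h₂
      (add 1ℚ (var 3F) (var 2F) h₃
      []))) refl

  sum-part : ∀ s l r → 0ℚ ≤ r → l + r ≤ s → l ≤ s
  sum-part s l r h₁ h₂ =
    linear-≤ (s ∷ l ∷ r ∷ []) (var 1F) (var 0F)
      (add 1ℚ :0 (var 2F) h₁
      (add 1ℚ (var 1F :+ var 2F) (var 0F) h₂
      [])) refl

  -- Here 2/5 s ≤ L/2 < x, hence x + s ≥ 7/5 s, and deleting x alone leaves at most 5/7 of the load.
  trim₂-large : ∀ L x s → ½ * L < x → x ≤ L → s ≤ (+ 5 / 4) * L → s ≤ (+ 4 / 5) * x + (+ 4 / 5) * s
  trim₂-large L x s h₁ h₂ h₃ =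
    linear-≤ (L ∷ x ∷ s ∷ []) (var 2F) ((+ 4 / 5) :* var 1F :+ (+ 4 / 5) :* var 2F)
      (add (+ 11 / 10) (½ :* var 0F) (var 1F) (<⇒≤ h₁)
      (add (+ 3 / 10) (var 1F) (var 0F) h₂
      (add (+ 1 / 5) (var 2F) ((+ 5 / 4) :* var 0F) h₃
      []))) refl

  -- Two deletions leave 4/5 s of the old load s, which is at most 4/5 times 5/7 of the new one, and
  -- 4/7 ≤ 3/5.
  trim₃-large : ∀ L x s → ½ * L < x → x ≤ L → s ≤ (+ 5 / 4) * L → (+ 4 / 5) * s ≤ (+ 3 / 5) * x + (+ 3 / 5) * s
  trim₃-large L x s h₁ h₂ h₃ =
    linear-≤ (L ∷ x ∷ s ∷ []) ((+ 4 / 5) :* var 2F) ((+ 3 / 5) :* var 1F :+ (+ 3 / 5) :* var 2F)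
      (add (+ 7 / 10) (½ :* var 0F) (var 1F) (<⇒≤ h₁)
      (add (+ 1 / 10) (var 1F) (var 0F) h₂
      (add (+ 1 / 5) (var 2F) ((+ 5 / 4) :* var 0F) h₃
      []))) refl

  -- This is where 3/5 times 5/4 equals 3/4 exactly.
  trim₄-large : ∀ L s → s ≤ (+ 5 / 4) * L → (+ 3 / 5) * s ≤ (+ 3 / 4) * L
  trim₄-large L s h₁ =
    linear-≤ (L ∷ s ∷ []) ((+ 3 / 5) :* var 1F) ((+ 3 / 4) :* var 0F)
      (add (+ 3 / 5) (var 1F) ((+ 5 / 4) :* var 0F) h₁
      []) refl

  -- Two large jobs weigh at least L, while x + s ≤ L/2 + 9/4 L + 3/4 L = 7/2 L; so deleting them
  -- removes at least a fifth of the load.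
  trim₂-small : ∀ L x s b l r → x ≤ ½ * L → 0ℚ ≤ x → s ≤ l + r → l ≤ (+ 9 / 4) * L → r ≤ (+ 3 / 4) * L → b + L ≤ s → x + b ≤ (+ 4 / 5) * x + (+ 4 / 5) * s
  trim₂-small L x s b l r h₁ h₂ h₃ h₄ h₅ h₆ =
    linear-≤ (L ∷ x ∷ s ∷ b ∷ l ∷ r ∷ []) (var 1F :+ var 3F) ((+ 4 / 5) :* var 1F :+ (+ 4 / 5) :* var 2F)
      (add (+ 4 / 5) (var 1F) (½ :* var 0F) h₁
      (add (+ 3 / 5) :0 (var 1F) h₂
      (add (+ 1 / 5) (var 2F) (var 4F :+ var 5F) h₃
      (add (+ 1 / 5) (var 4F) ((+ 9 / 4) :* var 0F) h₄
      (add (+ 1 / 5) (var 5F) ((+ 3 / 4) :* var 0F) h₅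
      (add 1ℚ (var 3F :+ var 0F) (var 2F) h₆
      [])))))) refl

  -- Three large jobs weigh at least 3/2 L, and two fifths of 7/2 L are only 7/5 L.
  trim₃-small : ∀ L x s b l r → x ≤ ½ * L → 0ℚ ≤ x → s ≤ l + r → l ≤ (+ 9 / 4) * L → r ≤ (+ 3 / 4) * L → b + (+ 3 / 2) * L ≤ s → x + b ≤ (+ 3 / 5) * x + (+ 3 / 5) * s
  trim₃-small L x s b l r h₁ h₂ h₃ h₄ h₅ h₆ =
    linear-≤ (L ∷ x ∷ s ∷ b ∷ l ∷ r ∷ []) (var 1F :+ var 3F) ((+ 3 / 5) :* var 1F :+ (+ 3 / 5) :* var 2F)
      (add (+ 3 / 5) (var 1F) (½ :* var 0F) h₁
      (add (+ 1 / 5) :0 (var 1F) h₂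
      (add (+ 2 / 5) (var 2F) (var 4F :+ var 5F) h₃
      (add (+ 2 / 5) (var 4F) ((+ 9 / 4) :* var 0F) h₄
      (add (+ 2 / 5) (var 5F) ((+ 3 / 4) :* var 0F) h₅
      (add 1ℚ (var 3F :+ (+ 3 / 2) :* var 0F) (var 2F) h₆
      [])))))) refl

  -- Deleting x first leaves the old jobs with one deletion less, so `trim₃` and `trim₄` come from
  -- the old `trim₂` and `trim₃`; for `trim₂` deleting x suffices.
  Balanced-large : ∀ L x xs → ½ * L < x → x ≤ L → 0ℚ ≤ x → sumℚ xs ≤ (+ 5 / 4) * L →
                   Balanced L xs → Balanced L (x ∷ xs)
  Balanced-large L x xs big x≤L 0≤x s≤ (balanced nn f h t₂ t₃ t₄) = balanced
    (0≤x ∷ nn)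
    (subst (λ ys → length ys ℕ.≤ 3) (sym keeps) (ℕ.s≤s two))
    (subst (λ ys → sumℚ ys ≤ (+ 9 / 4) * L) (sym keeps) (heavy-large L x s l x≤L s≤ l≤s))
    (inj₁ (Trim-drop x (Trim-none (scaled (+ 4 / 5) (trim₂-large L x s big x≤L s≤)))))
    (⊎-map (λ t → Trim-drop x (Trim-mono ℕ.≤-refl (scaled (+ 3 / 5) (trim₃-large L x s big x≤L s≤)) t))
           (Trim-drop x) t₂)
    (Trim-drop x ([ Trim-mono ℕ.≤-refl (trim₄-large L s s≤) , id ]′ t₃))
    where
    s l : ℚ
    s = sumℚ xs
    l = sumℚ (filterᵇ (large (½ * L)) xs)
    keeps : filterᵇ (large (½ * L)) (x ∷ xs) ≡ x ∷ filterᵇ (large (½ * L)) xs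
    keeps rewrite ≤ᵇ-false {x} {½ * L} big = refl
    l≤s : l ≤ s
    l≤s = sum-part s l _ (sumℚ-nonneg (filterᵇ-nonneg (small (½ * L)) nn)) (≤-reflexive (sym (sum-small-large (½ * L) xs)))
    scaled : ∀ c {y} → y ≤ c * x + c * s → y ≤ c * (x + s)
    scaled c {y} = subst (y ≤_) (sym (*-distribˡ-+ c x s))
    two : length (filterᵇ (large (½ * L)) xs) ℕ.≤ 2
    two = ℕ.≮⇒≥ λ lt → let b , 0≤b , le , _ = Trim-large₃ L xs nn lt in
      three-large L x s b big x≤L 0≤b le s≤

  -- Deleting x and all k ≤ 3 large jobs leaves the old small jobs, at most 3/4 L. Where k + 1
  -- deletions are too many, x is kept and only large jobs are deleted, which gives the relative
  -- bound.
  Balanced-small : ∀ L x xs → x ≤ ½ * L → 0ℚ ≤ x → sumℚ (filterᵇ (small (½ * L)) xs) ≤ (+ 3 / 4) * L →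
                   Balanced L xs → Balanced L (x ∷ xs)
  Balanced-small L x xs sm 0≤x r≤ (balanced nn f h t₂ t₃ t₄) = balanced
    (0≤x ∷ nn)
    (subst (λ ys → length ys ℕ.≤ 3) (sym skips) f)
    (subst (λ ys → sumℚ ys ≤ (+ 9 / 4) * L) (sym skips) h)
    two three
    (Trim-mono (ℕ.s≤s f) ≤-refl rest)
    where
    s l r : ℚ
    s = sumℚ xs
    l = sumℚ (filterᵇ (large (½ * L)) xs)
    r = sumℚ (filterᵇ (small (½ * L)) xs)
    k : ℕ
    k = length (filterᵇ (large (½ * L)) xs)
    skips : filterᵇ (large (½ * L)) (x ∷ xs) ≡ filterᵇ (large (½ * L)) xs
    skips rewrite ≤ᵇ-true {x} {½ * L} sm = refl
    s≤l+r : s ≤ l + r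
    s≤l+r = ≤-reflexive (sum-small-large (½ * L) xs)
    rest : Trim (suc k) (x ∷ xs) ((+ 3 / 4) * L)
    rest = Trim-drop x (Trim-mono ℕ.≤-refl r≤ (Trim-filterᵇ (small (½ * L)) xs))
    scaled : ∀ c {y} → y ≤ c * x + c * s → y ≤ c * (x + s)
    scaled c {y} = subst (y ≤_) (sym (*-distribˡ-+ c x s))
    two : Trim 2 (x ∷ xs) ((+ 4 / 5) * (x + s)) ⊎ Trim 2 (x ∷ xs) ((+ 3 / 4) * L)
    two = case k ℕ.≤? 1 of λ where
      (yes le) → inj₂ (Trim-mono (ℕ.s≤s le) ≤-refl rest)
      (no ¬le) → let b , _ , le , t = Trim-large₂ L xs nn (ℕ.≰⇒> ¬le) in
        inj₁ (Trim-mono ℕ.≤-refl (scaled (+ 4 / 5) (trim₂-small L x s b l r sm 0≤x s≤l+r h r≤ le)) (Trim-keep x t))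
    three : Trim 3 (x ∷ xs) ((+ 3 / 5) * (x + s)) ⊎ Trim 3 (x ∷ xs) ((+ 3 / 4) * L)
    three = case k ℕ.≤? 2 of λ where
      (yes le) → inj₂ (Trim-mono (ℕ.s≤s le) ≤-refl rest)
      (no ¬le) → let b , _ , le , t = Trim-large₃ L xs nn (ℕ.≰⇒> ¬le) in
        inj₁ (Trim-mono ℕ.≤-refl (scaled (+ 3 / 5) (trim₃-small L x s b l r sm 0≤x s≤l+r h r≤ le)) (Trim-keep x t))

  -- Greedy removal of largest jobs.

  ∈-↭-∷ : ∀ {x : ℚ} {xs} → x ∈ xs → ∃ λ ys → xs ↭ x ∷ ys
  ∈-↭-∷ {x} x∈xs with ∈-∃++ x∈xs
  ... | us , vs , refl = us ++ vs , shift x us vs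

  exchange : ∀ d x s b → d ≤ x → x + s ≤ b → d + s ≤ b
  exchange d x s b h₁ h₂ =
    linear-≤ (d ∷ x ∷ s ∷ b ∷ []) (var 0F :+ var 2F) (var 3F)
      (add 1ℚ (var 0F) (var 1F) h₁
      (add 1ℚ (var 1F :+ var 2F) (var 3F) h₂
      [])) refl

  -- An optimal choice of k deletions can be exchanged to start with the largest element.
  Trim-greedy : ∀ {x xs ys k b} → xs ↭ x ∷ ys → All (_≤ x) ys → b < sumℚ xs → Trim k xs b →
                ∃ λ k′ → k ≡ suc k′ × Trim k′ ys b
  Trim-greedy {x} {xs} {ys} {k} {b} p max big (ds , es , q , le , s)
    with ∈-++⁻ ds (∈-resp-↭ q (∈-resp-↭ (↭-sym p) (here refl)))
  Trim-greedy {x} {xs} {ys} {zero} p max big ([] , es , q , le , s) | _ =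
    contradiction (<-≤-trans big (≤-trans (≤-reflexive (sumℚ-↭ q)) s)) (<-irrefl refl)
  Trim-greedy {x} {xs} {ys} {suc k} p max big ([] , es , q , le , s) | _ =
    contradiction (<-≤-trans big (≤-trans (≤-reflexive (sumℚ-↭ q)) s)) (<-irrefl refl)
  Trim-greedy {x} {xs} {ys} {suc k} p max big (d ∷ ds , es , q , le , s) | inj₁ x∈ds with ∈-↭-∷ x∈ds
  ... | ds′ , r = k , refl , ds′ , es ,
    drop-∷ (↭-trans (↭-sym p) (↭-trans q (++⁺ʳ es r))) ,
    ℕ.s≤s⁻¹ (subst (ℕ._≤ suc k) (↭-length r) le) , s
  -- The largest element x was kept: keep the deleted d ≤ x in its place and delete x, which does
  -- not increase the remaining sum.
  Trim-greedy {x} {xs} {ys} {suc k} {b} p max big (d ∷ ds , es , q , le , s) | inj₂ x∈es with ∈-↭-∷ x∈es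
  ... | es′ , r = k , refl , ds , d ∷ es′ ,
    ↭-trans (drop-∷ swapped) (↭-sym (shift d ds es′)) , ℕ.s≤s⁻¹ le ,
    exchange d x (sumℚ es′) b d≤x (subst (_≤ b) (sumℚ-↭ r) s)
    where
    swapped : x ∷ ys ↭ x ∷ d ∷ ds ++ es′
    swapped = ↭-trans (↭-sym p) (↭-trans q (↭-trans (++⁺ˡ (d ∷ ds) r) (shift x (d ∷ ds) es′)))
    d≤x : d ≤ x
    d≤x with ∈-resp-↭ (↭-trans (↭-sym q) p) (here refl)
    ... | here refl = ≤-refl
    ... | there d∈ys = All.lookup max d∈ys

  keep-quarter : ∀ L x s → (+ 3 / 4) * L < x + s → x ≤ ½ * L → (+ 1 / 4) * L < s
  keep-quarter L x s h₁ h₂ =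
    linear-< (L ∷ x ∷ s ∷ []) ((+ 1 / 4) :* var 0F) (var 2F) 1ℚ ((+ 3 / 4) :* var 0F) (var 1F :+ var 2F) h₁
      (add 1ℚ (var 1F) (½ :* var 0F) h₂
      []) refl

  filterᵇ-small-all : ∀ θ {xs} → All (_≤ θ) xs → filterᵇ (small θ) xs ≡ xs
  filterᵇ-small-all θ []               = refl
  filterᵇ-small-all θ {x ∷ _} (h ∷ hs) rewrite ≤ᵇ-true {x} {θ} h = cong (x ∷_) (filterᵇ-small-all θ hs)

  -- If the largest job is large, the small jobs are untouched. If it is small, all jobs are, and a
  -- load above 3/4 L loses at most L/2.
  small-load-greedy : ∀ L {x xs ys} → xs ↭ x ∷ ys → All (_≤ x) ys → (+ 3 / 4) * L < sumℚ xs →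
                      (+ 1 / 4) * L < sumℚ (filterᵇ (small (½ * L)) xs) →
                      (+ 1 / 4) * L < sumℚ (filterᵇ (small (½ * L)) ys)
  small-load-greedy L {x} {xs} {ys} p max big l with x ≤? ½ * L
  ... | yes h = subst (λ zs → (+ 1 / 4) * L < sumℚ zs)
      (sym (filterᵇ-small-all (½ * L) (All.map (λ y≤x → ≤-trans y≤x h) max)))
      (keep-quarter L x (sumℚ ys) (subst ((+ 3 / 4) * L <_) (sumℚ-↭ p) big) h)
  ... | no ¬h = subst ((+ 1 / 4) * L <_)
      (trans (sumℚ-↭ (filter-↭ (T? ∘ small (½ * L)) p)) (cong sumℚ skip)) l
    where
    skip : filterᵇ (small (½ * L)) (x ∷ ys) ≡ filterᵇ (small (½ * L)) ys
    skip rewrite ≤ᵇ-false {x} {½ * L} (≰⇒> ¬h) = refl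

  -- Division by m, order statistics and jobs above half a load.

  -- Unnormalised fractions are compared by cross-multiplication, which avoids the gcd hidden in the
  -- normal form of the sum.
  toℚᵘ-·-unit : ∀ j k → toℚᵘ (j · (+ 1 / suc k)) ℚᵘ.≃ ℚᵘ.mkℚᵘ (+ j) k
  toℚᵘ-·-unit zero    k = ℚᵘ.*≡* refl
  toℚᵘ-·-unit (suc j) k = ℚᵘ.≃-trans (toℚᵘ-homo-+ (+ 1 / suc k) (j · (+ 1 / suc k)))
    (ℚᵘ.≃-trans (ℚᵘ.+-cong (toℚᵘ-fromℚᵘ (ℚᵘ.mkℚᵘ (+ 1) k)) (toℚᵘ-·-unit j k)) (ℚᵘ.*≡* eq))
    where
    eq : (+ 1 ℤ.* + suc k ℤ.+ + j ℤ.* + suc k) ℤ.* + suc k ≡ + suc j ℤ.* (+ suc k ℤ.* + suc k)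
    eq = trans (cong (ℤ._* + suc k) (sym (ℤ.*-distribʳ-+ (+ suc k) (+ 1) (+ j)))) (ℤ.*-assoc (+ suc j) (+ suc k) (+ suc k))

  ·-unit : ∀ k → suc k · (+ 1 / suc k) ≡ 1ℚ
  ·-unit k = toℚᵘ-injective (ℚᵘ.≃-trans (toℚᵘ-·-unit (suc k) k) (ℚᵘ.*≡* (cong +_ (ℕ.*-comm (suc k) 1))))

  ·-*-comm : ∀ k x r → k · (x * r) ≡ x * (k · r)
  ·-*-comm zero    x r = sym (*-zeroʳ x)
  ·-*-comm (suc k) x r = trans (cong (_+_ (x * r)) (·-*-comm k x r)) (sym (*-distribˡ-+ x r (k · r)))

  ·-divℕ : ∀ m x → 1 ℕ.≤ m → m · divℕ x m ≡ x
  ·-divℕ (suc k) x _ = trans (·-*-comm (suc k) x (+ 1 / suc k)) (trans (cong (x *_) (·-unit k)) (*-identityʳ x))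

  ·-mono-< : ∀ m {x y} → 1 ℕ.≤ m → x < y → m · x < m · y
  ·-mono-< (suc k) _ h = +-mono-<-≤ h (·-mono k (<⇒≤ h))

  divℕ-≤ : ∀ m x y → 1 ℕ.≤ m → x ≤ m · y → divℕ x m ≤ y
  divℕ-≤ m x y 1≤m h = case divℕ x m ≤? y of λ where
    (yes le) → le
    (no ¬le) → contradiction
      (<-≤-trans (·-mono-< m 1≤m (≰⇒> ¬le)) (≤-trans (≤-reflexive (·-divℕ m x 1≤m)) h)) (<-irrefl refl)

  ≤-divℕ : ∀ m x y → 1 ℕ.≤ m → divℕ x m ≤ y → x ≤ m · y
  ≤-divℕ m x y 1≤m h = subst (_≤ m · y) (·-divℕ m x 1≤m) (·-mono m h)

  nthOr0-nonneg : ∀ k {xs} → All (0ℚ ≤_) xs → 0ℚ ≤ nthOr0 k xs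
  nthOr0-nonneg k       []       = ≤-refl
  nthOr0-nonneg zero    (h ∷ _)  = h
  nthOr0-nonneg (suc k) (_ ∷ hs) = nthOr0-nonneg k hs

  largest-nonneg : ∀ k {xs} → All (0ℚ ≤_) xs → 0ℚ ≤ largest k xs
  largest-nonneg k {xs} h = nthOr0-nonneg k (All-resp-↭ (↭-sym (sortDesc-↭ xs)) h)

  -- Taken at the threshold `largest k ys`: a greater value for `xs` would put k + 1 elements above
  -- it, while `ys` has at most k.
  largest-mono : ∀ k xs ys → All (0ℚ ≤_) ys → (∀ θ → count> θ xs ≤ count> θ ys) → largest k xs ≤ largest k ys
  largest-mono k xs ys 0≤ys h = case largest k xs ≤? largest k ys of λ where
    (yes le) → le
    (no ¬le) → contradiction
      (≤-trans (largest-count>-≥ (largest k ys) k xs (largest-nonneg k 0≤ys) (≰⇒> ¬le))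
        (≤-trans (h (largest k ys)) (largest-count>-≤ (largest k ys) k ys ≤-refl)))
      (<⇒≱ (subst (_< 1ℚ + k · 1ℚ) (+-identityˡ (k · 1ℚ)) (+-monoˡ-< (k · 1ℚ) 0<1)))

  ∈-≤-sumℚ : ∀ {x xs} → All (0ℚ ≤_) xs → x ∈ xs → x ≤ sumℚ xs
  ∈-≤-sumℚ {x} (h ∷ hs) (here refl) = ≤-trans (≤-reflexive (sym (+-identityʳ x))) (+-monoʳ-≤ x (sumℚ-nonneg hs))
  ∈-≤-sumℚ (h ∷ hs) (there i)   = ≤-trans (≤-reflexive (sym (+-identityˡ _))) (+-mono-≤ h (∈-≤-sumℚ hs i))

  tail-small : ∀ M y s → ½ * M < y → y + s ≤ M → s ≤ ½ * M
  tail-small M y s h₁ h₂ =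
    linear-≤ (M ∷ y ∷ s ∷ []) (var 2F) (½ :* var 0F)
      (add 1ℚ (½ :* var 0F) (var 1F) (<⇒≤ h₁)
      (add 1ℚ (var 1F :+ var 2F) (var 0F) h₂
      [])) refl

  tail-bound : ∀ M y s → 0ℚ ≤ y → y + s ≤ M → s ≤ M
  tail-bound M y s h₁ h₂ =
    linear-≤ (M ∷ y ∷ s ∷ []) (var 2F) (var 0F)
      (add 1ℚ :0 (var 1F) h₁
      (add 1ℚ (var 1F :+ var 2F) (var 0F) h₂
      [])) refl

  -- Once one element exceeds M/2, the others sum to at most M/2.
  count>-half : ∀ M ys → All (0ℚ ≤_) ys → sumℚ ys ≤ M → count> (½ * M) ys ≤ 1ℚ
  count>-half M []       _            _ = 0≤1
  count>-half M (y ∷ ys) (0≤y ∷ 0≤ys) h = case y ≤? ½ * M of λ where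
    (yes le) → subst (_≤ 1ℚ)
      (sym (trans (cong (_+ count> (½ * M) ys) (above-0 (½ * M) le)) (+-identityˡ _)))
      (count>-half M ys 0≤ys (tail-bound M y (sumℚ ys) 0≤y h))
    (no ¬le) → ≤-reflexive (cong₂ _+_ (above-1 (½ * M) (≰⇒> ¬le)) (count>-0 (½ * M)
      (All.tabulate λ z∈ → ≤-trans (∈-≤-sumℚ 0≤ys z∈) (tail-small M y (sumℚ ys) (≰⇒> ¬le) h))))

  half-below : ∀ M v → M < (+ 2 / 1) * v → ½ * M < v
  half-below M v h₁ =
    linear-< (M ∷ v ∷ []) (½ :* var 0F) (var 1F) ½ (var 0F) ((+ 2 / 1) :* var 1F) h₁
      [] refl

  half-≤ : ∀ M v → (+ 2 / 1) * v ≤ M → v ≤ ½ * M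
  half-≤ M v h₁ =
    linear-≤ (M ∷ v ∷ []) (var 1F) (½ :* var 0F)
      (add ½ ((+ 2 / 1) :* var 1F) (var 0F) h₁
      []) refl

  -- The lower bound L and its relation to the optimum.

  module Instance (m : ℕ) (1≤m : 1 ℕ.≤ m) (n : ℕ) (p : Fin n → ℚ) (0<p : ∀ i → 0ℚ < p i) where

    contents : (Fin n → Bool) → List ℚ
    contents P = map p (filterᵇ P (allFin n))

    weight : (Fin n → Bool) → ℚ
    weight P = sumℚ (contents P)

    0≤p : ∀ i → 0ℚ ≤ p i
    0≤p i = <⇒≤ (0<p i)

    contents-insert : ∀ {P Q} i → P i ≡ false → Q i ≡ true → (∀ k → k ≢ i → Q k ≡ P k) →
                      contents Q ↭ p i ∷ contents P
    contents-insert i pf qt h = map⁺ p (filterᵇ-insert (Unique.allFin⁺ n) (∈-allFin i) pf qt h)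

    contents-cong : ∀ {P Q} → (∀ k → P k ≡ Q k) → contents P ≡ contents Q
    contents-cong h = cong (map p) (filterᵇ-cong {xs = allFin n} (All.universal h _))

    All-contents : ∀ {R : ℚ → Set} {P} → (∀ i → P i ≡ true → R (p i)) → All R (contents P)
    All-contents {R} {P} h = All.map⁺ (All.map (λ {i} t → h i (T-true t)) (All.all-filter (T? ∘ P) (allFin n)))
      where
      T-true : ∀ {b} → T b → b ≡ true
      T-true {true} _ = refl

    contents-nonneg : ∀ P → All (0ℚ ≤_) (contents P)
    contents-nonneg P = All-contents λ i _ → 0≤p i

    weight-nonneg : ∀ P → 0ℚ ≤ weight P
    weight-nonneg P = sumℚ-nonneg (contents-nonneg P)

    weight-mono : ∀ {P Q} → (∀ i → P i ≡ true → Q i ≡ true) → weight P ≤ weight Q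
    weight-mono {P} {Q} h = sum-filterᵇ-mono {P = P} {Q} {p} (All.universal 0≤p (allFin n)) h

    ∈-contents : ∀ {P} i → P i ≡ true → p i ∈ contents P
    ∈-contents {P} i t = ∈-map⁺ p (∈-filter⁺ (T? ∘ P) (∈-allFin i) (subst T (sym t) _))

    p≤weight : ∀ {P} i → P i ≡ true → p i ≤ weight P
    p≤weight {P} i t = ∈-≤-sumℚ (contents-nonneg P) (∈-contents i t)

    arrived : ℕ → Fin n → Bool
    arrived k i = toℕ i ℕ.<ᵇ k

    L[_] : ℕ → ℚ
    L[ k ] = Lb m n p k

    fewer-large : ∀ {k k′} → k ℕ.≤ k′ → ∀ θ → count> θ (firstK m n p k) ≤ count> θ (firstK m n p k′)
    fewer-large {k} {k′} le θ = subst₂ _≤_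
      (cong sumℚ (map-∘ (filterᵇ (arrived k) (allFin n))))
      (cong sumℚ (map-∘ (filterᵇ (arrived k′) (allFin n))))
      (sum-filterᵇ-mono {P = arrived k} {arrived k′} {λ i → above θ (p i)}
        (All.universal (λ i → above-nonneg θ (p i)) (allFin n))
        (λ i t → <ᵇ-true (ℕ.<-≤-trans (true-<ᵇ t) le)))

    L-least : ∀ k y → pPlus m n p k ≤ m · y → largest 0 (firstK m n p k) ≤ y →
              (+ 2 / 1) * largest m (firstK m n p k) ≤ y → L[ k ] ≤ y
    L-least k y h₁ h₂ h₃ = ⊔-lub (⊔-lub (divℕ-≤ m (pPlus m n p k) y 1≤m h₁) h₂) h₃

    L-average : ∀ k → pPlus m n p k ≤ m · L[ k ]
    L-average k = ≤-divℕ m (pPlus m n p k) L[ k ] 1≤m (≤-trans (p≤p⊔q _ _) (p≤p⊔q _ _))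

    L-largest : ∀ k → largest 0 (firstK m n p k) ≤ L[ k ]
    L-largest k = ≤-trans (p≤q⊔p (divℕ (pPlus m n p k) m) _) (p≤p⊔q _ _)

    L-pair : ∀ k → (+ 2 / 1) * largest m (firstK m n p k) ≤ L[ k ]
    L-pair k = p≤q⊔p (divℕ (pPlus m n p k) m ⊔ largest 0 (firstK m n p k)) _

    L-nonneg : ∀ k → 0ℚ ≤ L[ k ]
    L-nonneg k = ≤-trans (largest-nonneg 0 (contents-nonneg (arrived k))) (L-largest k)

    -- Every term of the maximum grows with the set of arrived jobs; the order statistics are
    -- compared by counting.
    L-mono : ∀ {k k′} → k ℕ.≤ k′ → L[ k ] ≤ L[ k′ ]
    L-mono {k} {k′} le = L-least k L[ k′ ]
      (≤-trans (weight-mono (λ i t → <ᵇ-true (ℕ.<-≤-trans (true-<ᵇ t) le))) (L-average k′))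
      (≤-trans (grow 0) (L-largest k′))
      (≤-trans (*-monoˡ-≤-nonNeg (+ 2 / 1) (grow m)) (L-pair k′))
      where
      grow : ∀ j → largest j (firstK m n p k) ≤ largest j (firstK m n p k′)
      grow j = largest-mono j (firstK m n p k) (firstK m n p k′) (contents-nonneg (arrived k′)) (fewer-large le)

    -- A job above L would make the count above L positive, although the largest job is at most L.
    p≤L : ∀ i k → toℕ i ℕ.< k → p i ≤ L[ k ]
    p≤L i k lt = case p i ≤? L[ k ] of λ where
      (yes le) → le
      (no ¬le) → contradiction
        (≤-trans (subst (_≤ count> L[ k ] (firstK m n p k)) (above-1 L[ k ] (≰⇒> ¬le))
                   (∈-≤-sumℚ (All.map⁺ (All.universal (above-nonneg L[ k ]) _))
                              (∈-map⁺ (above L[ k ]) (∈-contents {arrived k} i (<ᵇ-true lt)))))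
                 (largest-count>-≤ L[ k ] 0 (firstK m n p k) (L-largest k)))
        (<⇒≱ 0<1)

    -- This is the content of the last term of L: the job of rank m + 1 has size at most L/2.
    few-large : ∀ k → count> (½ * L[ k ]) (firstK m n p k) ≤ m · 1ℚ
    few-large k = largest-count>-≤ (½ * L[ k ]) m (firstK m n p k) (half-≤ L[ k ] _ (L-pair k))

    firstK-n : firstK m n p n ≡ map p (allFin n)
    firstK-n = cong (map p) (filterᵇ-true (λ i → <ᵇ-true (Fin.toℕ<n i)) (allFin n))

    machine₀ : Fin m
    machine₀ = Fin.fromℕ< 1≤m

    -- The recursion inside makespan is a local function of Defs; the hole is solved by unification.
    mutual
      maxLoad : (Fin n → Fin m) → List (Fin m) → ℚ
      maxLoad σ js = _

      makespan≡maxLoad : ∀ σ → makespan m n p σ ≡ maxLoad σ (allFin m)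
      makespan≡maxLoad σ with allFin m
      ... | js = refl

    module _ (σ : Fin n → Fin m) where

      on : Fin m → Fin n → Bool
      on j i = sameMachine (σ i) j

      ≤-maxLoad : ∀ {j js} → j ∈ js → weight (on j) ≤ maxLoad σ js
      ≤-maxLoad {j} {j ∷ js} (here refl) = p≤p⊔q (weight (on j)) (maxLoad σ js)
      ≤-maxLoad {j} {k ∷ js} (there i)   = ≤-trans (≤-maxLoad i) (p≤q⊔p (weight (on k)) (maxLoad σ js))

      weight≤makespan : ∀ j → weight (on j) ≤ makespan m n p σ
      weight≤makespan j = subst (weight (on j) ≤_) (sym (makespan≡maxLoad σ)) (≤-maxLoad (∈-allFin j))

      makespan-nonneg : 0ℚ ≤ makespan m n p σ
      makespan-nonneg = ≤-trans (weight-nonneg (on machine₀)) (weight≤makespan machine₀)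

      -- One reason per term: loads average to the first; every job lies on some machine; and a
      -- machine holds at most one job above half the makespan, which excludes m + 1 of them.
      L≤makespan : L[ n ] ≤ makespan m n p σ
      L≤makespan = L-least n M
        (subst (_≤ m · M) (trans (sum-machines σ p (allFin n)) (cong sumℚ (sym firstK-n)))
          (≤-trans (sum-mono weight≤makespan) (≤-reflexive (sum-replicate m))))
        (case largest 0 (firstK m n p n) ≤? M of λ where
          (yes le) → le
          (no ¬le) → contradiction
            (≤-trans (largest-count>-≥ M 0 (firstK m n p n) makespan-nonneg (≰⇒> ¬le))
              (≤-reflexive (count>-0 M (All-contents {P = arrived n} λ i _ →
                ≤-trans (p≤weight i (sameMachine-refl (σ i))) (weight≤makespan (σ i))))))
            (<⇒≱ (subst (0ℚ <_) (sym (+-identityʳ 1ℚ)) 0<1)))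
        (case (+ 2 / 1) * largest m (firstK m n p n) ≤? M of λ where
          (yes le) → le
          (no ¬le) → contradiction
            (≤-trans (largest-count>-≥ (½ * M) m (firstK m n p n) half-nonneg
                       (half-below M (largest m (firstK m n p n)) (≰⇒> ¬le))) counted)
            (<⇒≱ (subst (_< 1ℚ + m · 1ℚ) (+-identityˡ (m · 1ℚ)) (+-monoˡ-< (m · 1ℚ) 0<1))))
        where
        M : ℚ
        M = makespan m n p σ
        half-nonneg : 0ℚ ≤ ½ * M
        half-nonneg = subst (_≤ ½ * M) (*-zeroʳ ½) (*-monoˡ-≤-nonNeg ½ makespan-nonneg)
        counted : count> (½ * M) (firstK m n p n) ≤ m · 1ℚ
        counted = subst (_≤ m · 1ℚ)
          (trans (sum-machines σ (λ i → above (½ * M) (p i)) (allFin n))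
                 (trans (cong sumℚ (map-∘ (allFin n))) (cong (count> (½ * M)) (sym firstK-n))))
          (≤-trans (sum-mono λ j → subst (_≤ 1ℚ) (cong sumℚ (sym (map-∘ (filterᵇ (on j) (allFin n)))))
                     (count>-half M (contents (on j)) (contents-nonneg (on j)) (weight≤makespan j)))
                   (≤-reflexive (sum-replicate m)))

  -- The arrival phase.

  filterᵇ-false : ∀ {A : Set} (xs : List A) → filterᵇ (λ _ → false) xs ≡ []
  filterᵇ-false []       = refl
  filterᵇ-false (x ∷ xs) = filterᵇ-false xs

  -- An invariant of prefixes is advanced by the job `t` that extends the prefix of length `toℕ t`.
  Fin-induction : ∀ {n} (Q : ℕ → Set) → Q 0 → (∀ (t : Fin n) → Q (toℕ t) → Q (suc (toℕ t))) → Q n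
  Fin-induction {n} Q q₀ step = go n ℕ.≤-refl
    where
    go : ∀ k → k ℕ.≤ n → Q k
    go zero    _  = q₀
    go (suc k) lt = subst (Q ∘ suc) (Fin.toℕ-fromℕ< lt)
      (step (Fin.fromℕ< lt) (subst Q (sym (Fin.toℕ-fromℕ< lt)) (go k (ℕ.<⇒≤ lt))))

  small-gap : ∀ L x → 0ℚ < x → 0ℚ ≤ L → L < (+ 5 / 4) * L + x
  small-gap L x h₁ h₂ =
    linear-< (L ∷ x ∷ []) (var 0F) ((+ 5 / 4) :* var 0F :+ var 1F) 1ℚ :0 (var 1F) h₁
      (add (+ 1 / 4) :0 (var 0F) h₂
      []) refl

  small-sum : ∀ L → 0ℚ ≤ L → L + L ≤ (+ 3 / 4) * L + (+ 5 / 4) * L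
  small-sum L _ =
    linear-≤ (L ∷ []) (var 0F :+ var 0F) ((+ 3 / 4) :* var 0F :+ (+ 5 / 4) :* var 0F)
      [] refl

  large-gap : ∀ L x → ½ * L < x → 0ℚ ≤ L → L < (+ 3 / 4) * L + x
  large-gap L x h₁ h₂ =
    linear-< (L ∷ x ∷ []) (var 0F) ((+ 3 / 4) :* var 0F :+ var 1F) 1ℚ (½ :* var 0F) (var 1F) h₁
      (add (+ 1 / 4) :0 (var 0F) h₂
      []) refl

  large-sum : ∀ L → 0ℚ ≤ L → L + L ≤ (+ 5 / 4) * L + (+ 3 / 4) * L
  large-sum L _ =
    linear-≤ (L ∷ []) (var 0F :+ var 0F) ((+ 5 / 4) :* var 0F :+ (+ 3 / 4) :* var 0F)
      [] refl

  scale-5/4 : ∀ L M y → y ≤ (+ 5 / 4) * L → L ≤ M → y ≤ (+ 5 / 4) * M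
  scale-5/4 L M y h₁ h₂ =
    linear-≤ (L ∷ M ∷ y ∷ []) (var 2F) ((+ 5 / 4) :* var 1F)
      (add 1ℚ (var 2F) ((+ 5 / 4) :* var 0F) h₁
      (add (+ 5 / 4) (var 0F) (var 1F) h₂
      [])) refl

  scale-3/4 : ∀ L M y → y ≤ (+ 3 / 4) * L → L ≤ M → y ≤ (+ 3 / 4) * M
  scale-3/4 L M y h₁ h₂ =
    linear-≤ (L ∷ M ∷ y ∷ []) (var 2F) ((+ 3 / 4) :* var 1F)
      (add 1ℚ (var 2F) ((+ 3 / 4) :* var 0F) h₁
      (add (+ 3 / 4) (var 0F) (var 1F) h₂
      [])) refl

  -- L is the bound at an arrival and M the final one. From 3/4 M < y ≤ 5/4 L follows L > 3/5 M, so
  -- s exceeds 9/20 M.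
  late-small : ∀ L M s y → y ≤ (+ 5 / 4) * L → (+ 3 / 4) * M < y → (+ 3 / 4) * L < s → L ≤ M → (+ 1 / 4) * M < s
  late-small L M s y h₁ h₂ h₃ h₄ =
    linear-< (L ∷ M ∷ s ∷ y ∷ []) ((+ 1 / 4) :* var 1F) (var 2F) 1ℚ ((+ 3 / 4) :* var 1F) (var 3F) h₂
      (add 1ℚ (var 3F) ((+ 5 / 4) :* var 0F) h₁
      (add 1ℚ ((+ 3 / 4) :* var 0F) (var 2F) (<⇒≤ h₃)
      (add ½ (var 0F) (var 1F) h₄
      []))) refl

  at-most-5/4 : ∀ L y → y ≤ (+ 3 / 4) * L → 0ℚ ≤ L → y ≤ (+ 5 / 4) * L
  at-most-5/4 L y h₁ h₂ =
    linear-≤ (L ∷ y ∷ []) (var 1F) ((+ 5 / 4) :* var 0F)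
      (add 1ℚ (var 1F) ((+ 3 / 4) :* var 0F) h₁
      (add ½ :0 (var 0F) h₂
      [])) refl

  tail-≤ : ∀ x y s t b → x + s ≤ y + t → y ≤ x → t ≤ b → s ≤ b
  tail-≤ x y s t b h₁ h₂ h₃ =
    linear-≤ (x ∷ y ∷ s ∷ t ∷ b ∷ []) (var 2F) (var 4F)
      (add 1ℚ (var 0F :+ var 2F) (var 1F :+ var 3F) h₁
      (add 1ℚ (var 1F) (var 0F) h₂
      (add 1ℚ (var 3F) (var 4F) h₃
      []))) refl

  module ArrivalPhase (m : ℕ) (1≤m : 1 ℕ.≤ m) (n : ℕ) (p : Fin n → ℚ) (0<p : ∀ i → 0ℚ < p i)
                      (choice : Fin n → Fin m)
                      (ok : ∀ t → ALG.Arrival.ArrivalOK m n p (+ 7 / 4) choice t) where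
    open Instance m 1≤m n p 0<p
    open ALG m n p (+ 7 / 4)
    open Arrival choice

    onBefore : Fin m → ℕ → Fin n → Bool
    onBefore j k i = arrived k i ∧ sameMachine (choice i) j

    -- The history of a machine by number of arrivals: `H j (toℕ t)` is what job `t` finds,
    -- `H j (suc (toℕ t))` the contents after it is placed.
    H : Fin m → ℕ → List ℚ
    H j k = contents (onBefore j k)

    arrived-other : ∀ (t i : Fin n) → i ≢ t → arrived (suc (toℕ t)) i ≡ arrived (toℕ t) i
    arrived-other t i i≢t = case toℕ i ℕ.<? toℕ t of λ where
      (yes lt) → trans (<ᵇ-true (ℕ.m<n⇒m<1+n lt)) (sym (<ᵇ-true lt))
      (no ¬lt) → trans (<ᵇ-false λ lt → i≢t (Fin.toℕ-injective (ℕ.≤-antisym (ℕ.s≤s⁻¹ lt) (ℕ.≮⇒≥ ¬lt))))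
                       (sym (<ᵇ-false ¬lt))

    H-0 : ∀ j → H j 0 ≡ []
    H-0 j = cong (map p) (filterᵇ-false (allFin n))

    H-here : ∀ {j} t → choice t ≡ j → H j (suc (toℕ t)) ↭ p t ∷ H j (toℕ t)
    H-here {j} t refl = contents-insert t
      (cong (_∧ sameMachine j j) (<ᵇ-false {toℕ t} (ℕ.<-irrefl refl)))
      (cong₂ _∧_ (<ᵇ-true (ℕ.n<1+n (toℕ t))) (sameMachine-refl j))
      (λ k ne → cong (_∧ sameMachine (choice k) j) (arrived-other t k ne))

    H-other : ∀ {j} t → choice t ≢ j → H j (suc (toℕ t)) ≡ H j (toℕ t)
    H-other {j} t ne = contents-cong λ k → case k Fin.≟ t of λ where
        (yes refl) → trans (off (arrived (suc (toℕ t)) t) (choice t) ne) (sym (off (arrived (toℕ t) t) (choice t) ne))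
        (no k≢t)   → cong (_∧ sameMachine (choice k) j) (arrived-other t k k≢t)
      where
      off : ∀ b k → k ≢ j → b ∧ sameMachine k j ≡ false
      off true  k k≢j = sameMachine-≢ k≢j
      off false k _   = refl

    -- At c = 7/4 the factors 2c - 3, c - 1, 3 - c evaluate to 1/2, 3/4, 5/4, so the tests of the
    -- algorithm agree with these thresholds by computation.
    ℓs≡ : ∀ j t → ℓs j t ≡ sumℚ (filterᵇ (small (½ * Lt t)) (H j (toℕ t)))
    ℓs≡ j t = cong sumℚ (sym (trans (filterᵇ-map (small (½ * Lt t)) p (filterᵇ (onBefore j (toℕ t)) (allFin n)))
      (cong (map p) (trans (filterᵇ-filterᵇ (onBefore j (toℕ t)) _ (allFin n))
        (filterᵇ-cong {xs = allFin n} (All.universal (λ i → ∧-assoc (arrived (toℕ t) i) _ _) _))))))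

    ℓs≤ℓ : ∀ j t → ℓs j t ≤ ℓ j t
    ℓs≤ℓ j t = weight-mono λ i h → case ∧-true {arrived (toℕ t) i} h of λ where
      (a , b) → cong₂ _∧_ a (proj₁ (∧-true {sameMachine (choice i) j} b))

    onBefore-mono : ∀ {j k k′} → k ℕ.≤ k′ → ∀ i → onBefore j k i ≡ true → onBefore j k′ i ≡ true
    onBefore-mono {j} {k} le i h = case ∧-true {arrived k i} h of λ where
      (a , b) → cong₂ _∧_ (<ᵇ-true (ℕ.<-≤-trans (true-<ᵇ a) le)) b

    -- If the least loaded machine of B were above β, all of B would be, and with A at α or more
    -- `crowded` contradicts the average.
    least-B-bound : ∀ t {α β} → LeastInB t (choice t) → Lt t < β + p t → Lt t + Lt t ≤ α + β →
                    (∀ a → InA m n p a → α ≤ ℓ a t) → ℓ (choice t) t ≤ β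
    least-B-bound t {α} {β} (t∈B , least) gap pair loadA = case ℓ (choice t) t ≤? β of λ where
        (yes le) → le
        (no ¬le) → ⊥-elim (crowded choice p (filterᵇ (arrived k) (allFin n)) {α} {β} {p t} {Lt t}
          (choice t) t∈B (0<p t) gap pair
          (λ a a∈A → ≤-trans (loadA a a∈A) (grown a))
          (λ b b∈B → ≤-trans (<⇒≤ (≰⇒> ¬le)) (≤-trans (least b b∈B) (grown b)))
          (subst (β + p t ≤_) (sym (loadOf≡ (choice t)))
            (subst (β + p t ≤_) (sym (sumℚ-↭ (H-here t refl)))
              (subst (_≤ p t + ℓ (choice t) t) (+-comm (p t) β) (+-monoʳ-≤ (p t) (<⇒≤ (≰⇒> ¬le))))))
          (L-average k))
      where
      -- `Lt t` already counts job `t`, so the average is taken after its placement, and `p t` is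
      -- the extra load on its machine.
      k : ℕ
      k = suc (toℕ t)
      loadOf≡ : ∀ j → sumℚ (map p (filterᵇ (λ i → sameMachine (choice i) j) (filterᵇ (arrived k) (allFin n))))
                    ≡ weight (onBefore j k)
      loadOf≡ j = cong (sumℚ ∘ map p) (filterᵇ-filterᵇ (arrived k) _ (allFin n))
      grown : ∀ j → ℓ j t ≤ sumℚ (map p (filterᵇ (λ i → sameMachine (choice i) j) (filterᵇ (arrived k) (allFin n))))
      grown j = subst (ℓ j t ≤_) (sym (loadOf≡ j)) (weight-mono (onBefore-mono {j} (ℕ.n≤1+n (toℕ t))))

    -- The acceptance rules supply the hypotheses: small load at most 3/4 for a small job; for a
    -- large job total load at most 5/4, since the chosen machine is least loaded in A.
    Balanced-step : ∀ {a} → InA m n p a → ∀ t → Balanced L[ toℕ t ] (H a (toℕ t)) → Balanced (Lt t) (H a (suc (toℕ t)))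
    Balanced-step {a} a∈A t bal = case choice t Fin.≟ a of λ where
        (no ne)    → subst (Balanced (Lt t)) (sym (H-other t ne)) bal′
        (yes refl) → Balanced-↭ (Lt t) (↭-sym (H-here t refl)) (assigned (ok t) refl)
      where
      bal′ : Balanced (Lt t) (H a (toℕ t))
      bal′ = Balanced-mono L[ toℕ t ] (Lt t) (L-mono (ℕ.n≤1+n (toℕ t))) bal
      assigned : ArrivalOK t → choice t ≡ a → Balanced (Lt t) (p t ∷ H a (toℕ t))
      assigned (small-A sm (_ , le) _) refl =
        Balanced-small (Lt t) (p t) (H a (toℕ t)) sm (0≤p t) (subst (_≤ (+ 3 / 4) * Lt t) (ℓs≡ a t) le) bal′
      assigned (small-B _ _ (a∈B , _)) refl = contradiction a∈A a∈B
      assigned (large-A ¬sm (b , b∈A , le) _ least) refl =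
        Balanced-large (Lt t) (p t) (H a (toℕ t)) (≰⇒> ¬sm) (p≤L t (suc (toℕ t)) (ℕ.n<1+n _)) (0≤p t)
          (≤-trans (least b b∈A) le) bal′
      assigned (large-B _ _ (a∈B , _)) refl = contradiction a∈A a∈B

    Balanced-final : ∀ {a} → InA m n p a → Balanced L (H a n)
    Balanced-final {a} a∈A = Fin-induction (λ k → Balanced L[ k ] (H a k))
      (subst (Balanced L[ 0 ]) (sym (H-0 a)) (Balanced-[] L[ 0 ] (L-nonneg 0)))
      (Balanced-step a∈A)

    SmallOnA : Set
    SmallOnA = ∀ a → InA m n p a → (+ 1 / 4) * L < sumℚ (filterᵇ (small (½ * L)) (H a n))

    -- A load on B together with the reason for any excess over 3/4 L: it arose while A was full of
    -- small jobs, of which more than L/4 lie on each machine of A at the end of the arrivals.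
    Light : ℚ → Set
    Light y = y ≤ (+ 5 / 4) * L × ((+ 3 / 4) * L < y → SmallOnA)

    Light-mono : ∀ {x y} → x ≤ y → Light y → Light x
    Light-mono x≤y (le , h) = ≤-trans x≤y le , λ lt → h (<-≤-trans lt x≤y)

    Lt≤L : ∀ t → Lt t ≤ L
    Lt≤L t = L-mono (Fin.toℕ<n t)

    -- The bound grows with time, so a job small at time t is still small at the end, and arrivals
    -- never move it.
    small-later : ∀ a t → ℓs a t ≤ sumℚ (filterᵇ (small (½ * L)) (H a n))
    small-later a t = subst (_≤ sumℚ (filterᵇ (small (½ * L)) (H a n))) (sym (ℓs≡ a t)) (≤-trans
      (sum-filterᵇ-id-mono (contents-nonneg (onBefore a (toℕ t))) (small-mono (*-monoˡ-≤-nonNeg ½ (Lt≤L t))))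
      (subst₂ _≤_ (cong sumℚ (filtered (toℕ t))) (cong sumℚ (filtered n))
        (sum-filterᵇ-mono {w = p} (All.universal 0≤p (allFin n)) λ i h →
          case ∧-true {onBefore a (toℕ t) i} h of λ where
            (b , s) → cong₂ _∧_ (onBefore-mono {a} (ℕ.<⇒≤ (Fin.toℕ<n t)) i b) s)))
      where
      filtered : ∀ k → map p (filterᵇ (λ i → onBefore a k i ∧ small (½ * L) (p i)) (allFin n))
                     ≡ filterᵇ (small (½ * L)) (H a k)
      filtered k = sym (trans (filterᵇ-map (small (½ * L)) p (filterᵇ (onBefore a k) (allFin n)))
        (cong (map p) (filterᵇ-filterᵇ (onBefore a k) _ (allFin n))))

    -- A small job goes to B only if every machine of A has small load above 3/4, which caps B at
    -- 5/4. A large job needs A above 5/4, which caps B at 3/4, so there is no excess to explain.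
    B-light : ∀ t → InB m n p (choice t) → Light (ℓ (choice t) t)
    B-light t t∈B = assigned (ok t)
      where
      0≤Lt : 0ℚ ≤ Lt t
      0≤Lt = L-nonneg (suc (toℕ t))
      assigned : ArrivalOK t → Light (ℓ (choice t) t)
      assigned (small-A _ (t∈A , _) _) = contradiction t∈A t∈B
      assigned (large-A _ _ t∈A _)     = contradiction t∈A t∈B
      assigned (small-B _ full least)  = scale-5/4 (Lt t) L (ℓ (choice t) t) bound (Lt≤L t) , λ big a a∈A →
        <-≤-trans (late-small (Lt t) L (ℓs a t) (ℓ (choice t) t) bound big (above¾ a a∈A) (Lt≤L t)) (small-later a t)
        where
        above¾ : ∀ a → InA m n p a → (+ 3 / 4) * Lt t < ℓs a t
        above¾ a a∈A = ≰⇒> λ le → full (a , a∈A , le)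
        bound : ℓ (choice t) t ≤ (+ 5 / 4) * Lt t
        bound = least-B-bound t least (small-gap (Lt t) (p t) (0<p t) 0≤Lt) (small-sum (Lt t) 0≤Lt)
          λ a a∈A → ≤-trans (<⇒≤ (above¾ a a∈A)) (ℓs≤ℓ a t)
      assigned (large-B ¬sm full least) =
        at-most-5/4 L (ℓ (choice t) t) bound (L-nonneg n) , λ big → contradiction bound (<⇒≱ big)
        where
        bound : ℓ (choice t) t ≤ (+ 3 / 4) * L
        bound = scale-3/4 (Lt t) L (ℓ (choice t) t)
          (least-B-bound t least (large-gap (Lt t) (p t) (≰⇒> ¬sm) 0≤Lt) (large-sum (Lt t) 0≤Lt)
            λ a a∈A → <⇒≤ (≰⇒> λ le → full (a , a∈A , le)))
          (Lt≤L t)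

    -- Here x is the job that arrived last on the machine and `ys` is what it found there.
    LastLight : List ℚ → Set
    LastLight xs = xs ≡ [] ⊎ ∃₂ λ x ys → xs ↭ x ∷ ys × Light (sumℚ ys)

    LastLight-final : ∀ {b} → InB m n p b → LastLight (H b n)
    LastLight-final {b} b∈B = Fin-induction (λ k → LastLight (H b k)) (inj₁ (H-0 b)) λ t last →
      case choice t Fin.≟ b of λ where
        (no ne)    → subst LastLight (sym (H-other t ne)) last
        (yes refl) → inj₂ (p t , H b (toℕ t) , H-here t refl , B-light t b∈B)

    -- The removed job is at least as large as the last arrival, so what remains weighs no more than
    -- what that arrival found.
    Light-remove : ∀ {xs x ys} → LastLight xs → xs ↭ x ∷ ys → All (_≤ x) xs → Light (sumℚ ys)
    Light-remove (inj₁ refl) r max = contradiction (↭-sym r) ¬x∷xs↭[]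
    Light-remove {xs} {x} {ys} (inj₂ (z , zs , q , light)) r max = Light-mono
      (tail-≤ x z (sumℚ ys) (sumℚ zs) (sumℚ zs)
        (≤-reflexive (sumℚ-↭ (↭-trans (↭-sym r) q))) (All.lookup max (∈-resp-↭ (↭-sym q) (here refl))) ≤-refl)
      light

  -- States of the migration phase and the removal of jobs.

  sum-updateAt : ∀ {m} (K : Fin m → ℕ) j {k} → K j ≡ suc k → sumℕ K ≡ suc (sumℕ (updateAt K j (λ _ → k)))
  sum-updateAt K zero    {k} eq = cong (ℕ._+ sumℕ (K ∘ suc)) eq
  sum-updateAt K (suc j) {k} eq =
    trans (cong (K zero ℕ.+_) (sum-updateAt (K ∘ suc) j eq)) (ℕ.+-suc (K zero) _)

  sum-tabulate : ∀ {m} (f : Fin m → ℕ) → sumᴸ (List.tabulate f) ≡ sumℕ f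
  sum-tabulate {zero}  f = refl
  sum-tabulate {suc m} f = cong (f zero ℕ.+_) (sum-tabulate (f ∘ suc))

  module States (m : ℕ) (1≤m : 1 ℕ.≤ m) (n : ℕ) (p : Fin n → ℚ) (0<p : ∀ i → 0ℚ < p i) where
    open Instance m 1≤m n p 0<p
    open ALG m n p (+ 7 / 4)

    private
      St = State m n p
      InA′ = InA m n p
      InB′ = InB m n p

    jobs : St → Fin m → List (Fin n)
    jobs s j = filterᵇ (onMachine m n p s j) (allFin n)

    loads : St → Fin m → List ℚ
    loads s j = map p (jobs s j)

    on-just : ∀ {s : St} {j i} → s i ≡ just j → onMachine m n p s j i ≡ true
    on-just {s} {j} {i} h with s i | h
    ... | just .j | refl = sameMachine-refl j

    just-on : ∀ {s : St} {j i} → onMachine m n p s j i ≡ true → s i ≡ just j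
    just-on {s} {j} {i} h with s i
    ... | just k = cong just (sameMachine-≡ h)

    off : ∀ {s : St} {j i} → s i ≢ just j → onMachine m n p s j i ≡ false
    off {s} {j} {i} h with onMachine m n p s j i in eq
    ... | true  = contradiction (just-on {s} eq) h
    ... | false = refl

    on-cong : ∀ {s s′ : St} {j i} → s i ≡ s′ i → onMachine m n p s j i ≡ onMachine m n p s′ j i
    on-cong {s} {s′} {j} {i} h with s i | s′ i | h
    ... | just _  | _ | refl = refl
    ... | nothing | _ | refl = refl

    unassign-same : ∀ (s : St) i → unassign s i i ≡ nothing
    unassign-same s i with i Fin.≟ i
    ... | yes _  = refl
    ... | no i≢i = contradiction refl i≢i

    unassign-other : ∀ (s : St) {i k} → k ≢ i → unassign s i k ≡ s k
    unassign-other s {i} {k} k≢i with i Fin.≟ k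
    ... | yes e = contradiction (sym e) k≢i
    ... | no _  = refl

    assign-same : ∀ (s : St) i j → assign s i j i ≡ just j
    assign-same s i j with i Fin.≟ i
    ... | yes _  = refl
    ... | no i≢i = contradiction refl i≢i

    assign-other : ∀ (s : St) {i j k} → k ≢ i → assign s i j k ≡ s k
    assign-other s {i} {j} {k} k≢i with i Fin.≟ k
    ... | yes e = contradiction (sym e) k≢i
    ... | no _  = refl

    jobs-insert : ∀ {s s′ : St} {i j} → s i ≢ just j → s′ i ≡ just j → (∀ k → k ≢ i → s′ k ≡ s k) →
                  jobs s′ j ↭ i ∷ jobs s j
    jobs-insert {s} {s′} {i} {j} h h′ same = filterᵇ-insert (Unique.allFin⁺ n) (∈-allFin i)
      (off {s} h) (on-just {s′} h′) λ k ne → on-cong {s′} {s} (same k ne)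

    jobs-unchanged : ∀ {s s′ : St} {i j} → s i ≢ just j → s′ i ≢ just j → (∀ k → k ≢ i → s′ k ≡ s k) →
                     jobs s′ j ≡ jobs s j
    jobs-unchanged {s} {s′} {i} {j} h h′ same = filterᵇ-cong {xs = allFin n} (All.universal (λ k →
      case k Fin.≟ i of λ where
        (yes refl) → trans (off {s′} h′) (sym (off {s} h))
        (no ne)    → on-cong {s′} {s} (same k ne)) _)

    just≢just : ∀ {j j′ : Fin m} {x} → x ≡ just j → j ≢ j′ → x ≢ just j′
    just≢just refl ne refl = ne refl

    nothing≢just : ∀ {j : Fin m} {x} → x ≡ nothing → x ≢ just j
    nothing≢just refl ()

    loads-unassign : ∀ (s : St) i {j} → s i ≡ just j → loads s j ↭ p i ∷ loads (unassign s i) j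
    loads-unassign s i {j} h = map⁺ p (jobs-insert {unassign s i} {s}
      (nothing≢just (unassign-same s i)) h λ k ne → sym (unassign-other s ne))

    loads-unassign-other : ∀ (s : St) i {j j′} → s i ≡ just j → j ≢ j′ → loads (unassign s i) j′ ≡ loads s j′
    loads-unassign-other s i h ne = cong (map p) (jobs-unchanged {s} {unassign s i} {i}
      (just≢just h ne) (nothing≢just (unassign-same s i)) λ k → unassign-other s)

    jobs-assign : ∀ (s : St) i j → s i ≡ nothing → jobs (assign s i j) j ↭ i ∷ jobs s j
    jobs-assign s i j h = jobs-insert {s} {assign s i j}
      (nothing≢just h) (assign-same s i j) λ k → assign-other s

    loads-assign-other : ∀ (s : St) i {j j′} → s i ≡ nothing → j ≢ j′ → loads (assign s i j) j′ ≡ loads s j′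
    loads-assign-other s i {j} h ne = cong (map p) (jobs-unchanged {s} {assign s i j} {i}
      (nothing≢just h) (just≢just (assign-same s i j) ne) λ k → assign-other s)

    largest-bound : ∀ {s : St} {j i} → (∀ k → s k ≡ just j → p k ≤ p i) → All (_≤ p i) (loads s j)
    largest-bound {s} {j} h = All-contents {P = onMachine m n p s j} λ k on → h k (just-on {s} on)

    -- Forgets the rule behind each removal and keeps what both phases share: removed jobs are
    -- unassigned and distinct, and loads only fall.
    data Removal : St → List (Fin n) → St → Set where
      []  : ∀ {s} → Removal s [] s
      _∷_ : ∀ {s i j R s′} → s i ≡ just j → Removal (unassign s i) R s′ → Removal s (i ∷ R) s′

    Removal-++ : ∀ {s R s′ R′ s″} → Removal s R s′ → Removal s′ R′ s″ → Removal s (R ++ R′) s″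
    Removal-++ []      q = q
    Removal-++ (h ∷ r) q = h ∷ Removal-++ r q

    RemoveB⇒Removal : ∀ {s js R s′} → RemoveB s js R s′ → Removal s R s′
    RemoveB⇒Removal done                          = []
    RemoveB⇒Removal (skipA _ r)                   = RemoveB⇒Removal r
    RemoveB⇒Removal (skipE _ _ r)                 = RemoveB⇒Removal r
    RemoveB⇒Removal (remove _ (h , _ , refl) r)   = h ∷ RemoveB⇒Removal r

    RemoveA⇒Removal : ∀ {s R s′} → RemoveA s R s′ → Removal s R s′
    RemoveA⇒Removal (stop _)                    = []
    RemoveA⇒Removal (step _ _ (h , _ , refl) r) = h ∷ RemoveA⇒Removal r

    Removal-keeps : ∀ {s R s′ k} → Removal s R s′ → s k ≡ nothing → s′ k ≡ nothing × All (k ≢_) R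
    Removal-keeps []                      h = h , []
    Removal-keeps {s} {i ∷ _} {k = k} (on ∷ r) h =
      let k≢i = λ { refl → nothing≢just h on }
          h′ , rest = Removal-keeps r (trans (unassign-other s k≢i) h)
      in h′ , k≢i ∷ rest

    Removal-removes : ∀ {s R s′} → Removal s R s′ → All (λ i → s′ i ≡ nothing) R × Unique R
    Removal-removes []                  = [] , []
    Removal-removes {s} {i ∷ _} (_ ∷ r) =
      let gone , new = Removal-keeps r (unassign-same s i)
          rest , unique = Removal-removes r
      in gone ∷ rest , new ∷ unique

    load-unassign-≤ : ∀ (s : St) i {j} j′ → s i ≡ just j → load m n p (unassign s i) j′ ≤ load m n p s j′
    load-unassign-≤ s i j′ h = weight-mono λ k on → on-just {s} (kept k (just-on {unassign s i} on))
      where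
      kept : ∀ k → unassign s i k ≡ just j′ → s k ≡ just j′
      kept k eq = case k Fin.≟ i of λ where
        (yes refl) → contradiction eq (nothing≢just (unassign-same s i))
        (no ne)    → trans (sym (unassign-other s ne)) eq

    Removal-load : ∀ {s R s′} j → Removal s R s′ → load m n p s′ j ≤ load m n p s j
    Removal-load j []      = ≤-refl
    Removal-load {s} {i ∷ _} j (h ∷ r) = ≤-trans (Removal-load j r) (load-unassign-≤ s i j h)

    A≢B : ∀ {a b} → InA′ a → InB′ b → b ≢ a
    A≢B a∈A b∈B refl = b∈B a∈A

    RemoveB-loads-A : ∀ {s js R s′ a} → RemoveB s js R s′ → InA′ a → loads s′ a ≡ loads s a
    RemoveB-loads-A done                             a∈A = refl
    RemoveB-loads-A (skipA _ r)                      a∈A = RemoveB-loads-A r a∈A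
    RemoveB-loads-A (skipE _ _ r)                    a∈A = RemoveB-loads-A r a∈A
    RemoveB-loads-A {s} {R = i ∷ _} (remove j∈B (h , _ , refl) r) a∈A =
      trans (RemoveB-loads-A r a∈A) (loads-unassign-other s i h (A≢B a∈A j∈B))

    RemoveA-loads-B : ∀ {s R s′ b} → RemoveA s R s′ → InB′ b → loads s′ b ≡ loads s b
    RemoveA-loads-B (stop _)                      b∈B = refl
    RemoveA-loads-B {s} {i ∷ _} (step j∈A _ (h , _ , refl) r) b∈B =
      trans (RemoveA-loads-B r b∈B) (loads-unassign-other s i h (A≢B j∈A b∈B ∘ sym))

    RemoveA-final : ∀ {s R s′} → RemoveA s R s′ → ∀ a → InA′ a → load m n p s′ a ≤ (+ 3 / 4) * L
    RemoveA-final (stop h)       = h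
    RemoveA-final (step _ _ _ r) = RemoveA-final r

    -- Every removal hits a machine of A above 3/4 L, so `small-load-greedy` applies there; other
    -- machines are unchanged.
    RemoveA-small : ∀ {s R s′ a} → RemoveA s R s′ → (+ 1 / 4) * L < sumℚ (filterᵇ (small (½ * L)) (loads s a)) →
                    (+ 1 / 4) * L < sumℚ (filterᵇ (small (½ * L)) (loads s′ a))
    RemoveA-small (stop _) l = l
    RemoveA-small {s} {i ∷ _} {a = a} (step {j = j} j∈A big (h , max , refl) r) l = RemoveA-small r (case j Fin.≟ a of λ where
      (yes refl) → small-load-greedy L (loads-unassign s i h)
        (All.tail (All-resp-↭ (loads-unassign s i h) (largest-bound {s} max))) big l
      (no ne)    → subst (λ xs → (+ 1 / 4) * L < sumℚ (filterᵇ (small (½ * L)) xs))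
        (sym (loads-unassign-other s i h ne)) l)

    -- `K` is a budget of deletions per machine. A removal takes the largest job of a machine above
    -- 3/4 L, so by `Trim-greedy` the budget of that machine is positive and drops by one.
    RemoveA-length : ∀ {s R s′} → RemoveA s R s′ → (K : Fin m → ℕ) →
                     (∀ a → InA′ a → Trim (K a) (loads s a) ((+ 3 / 4) * L)) → length R ℕ.≤ sumℕ K
    RemoveA-length (stop _) K t = ℕ.z≤n
    RemoveA-length {s} {i ∷ R} (step {j = j} j∈A big (h , max , refl) r) K t =
      let k , Kj≡ , t′ = Trim-greedy (loads-unassign s i h)
            (All.tail (All-resp-↭ (loads-unassign s i h) (largest-bound {s} max))) big (t j j∈A)
      in subst (suc (length R) ℕ.≤_) (sym (sum-updateAt K j Kj≡))
           (ℕ.s≤s (RemoveA-length r (updateAt K j (λ _ → k)) λ a a∈A → case j Fin.≟ a of λ where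
             (yes refl) → subst (λ k → Trim k (loads (unassign s i) j) ((+ 3 / 4) * L)) (sym (updateAt-updates j K)) t′
             (no ne)    → subst₂ (λ k xs → Trim k xs ((+ 3 / 4) * L))
               (sym (updateAt-minimal a j K (ne ∘ sym))) (sym (loads-unassign-other s i h ne)) (t a a∈A)))

    onlyB : Fin m → ℕ
    onlyB j = if toℕ j ℕ.<ᵇ m ℕ./ 2 then 0 else 1

    RemoveB-length : ∀ {s js R s′} → RemoveB s js R s′ → length R ℕ.≤ sumᴸ (map onlyB js)
    RemoveB-length done                                        = ℕ.z≤n
    RemoveB-length {js = j ∷ js} (skipA _ r)                   = ℕ.m≤n⇒m≤o+n (onlyB j) (RemoveB-length r)
    RemoveB-length {js = j ∷ js} (skipE _ _ r)                 = ℕ.m≤n⇒m≤o+n (onlyB j) (RemoveB-length r)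
    RemoveB-length {js = j ∷ js} {R = _ ∷ R} (remove j∈B _ r)  =
      subst (λ k → suc (length R) ℕ.≤ k ℕ.+ sumᴸ (map onlyB js))
            (sym (cong (if_then 0 else 1) (<ᵇ-false j∈B))) (ℕ.s≤s (RemoveB-length r))

  -- The machines of B after the removal.

  module Migration (m : ℕ) (1≤m : 1 ℕ.≤ m) (n : ℕ) (p : Fin n → ℚ) (0<p : ∀ i → 0ℚ < p i)
                   (choice : Fin n → Fin m)
                   (ok : ∀ t → ALG.Arrival.ArrivalOK m n p (+ 7 / 4) choice t) where
    open Instance m 1≤m n p 0<p
    open States m 1≤m n p 0<p
    open ArrivalPhase m 1≤m n p 0<p choice ok
    open ALG m n p (+ 7 / 4)
    open Arrival choice

    loads-arrival : ∀ j → loads arrivalSchedule j ≡ H j n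
    loads-arrival j = contents-cong λ i → sym (cong (_∧ sameMachine (choice i) j) (<ᵇ-true (Fin.toℕ<n i)))

    Light-0 : Light 0ℚ
    Light-0 = scale (+ 5 / 4) , λ lt → contradiction (scale (+ 3 / 4)) (<⇒≱ lt)
      where
      scale : ∀ c {{_ : NonNegative c}} → 0ℚ ≤ c * L
      scale c = subst (_≤ c * L) (*-zeroʳ c) (*-monoˡ-≤-nonNeg c (L-nonneg n))

    Removal-Light : ∀ {s R s′ b} → Removal s R s′ → Light (load m n p s b) → Light (load m n p s′ b)
    Removal-Light {b = b} r = Light-mono (Removal-load b r)

    -- Until the scan reaches b its load is unchanged; then its largest job leaves, unless it is
    -- empty; afterwards the load only falls.
    RemoveB-Light : ∀ {s js R s′ b} → RemoveB s js R s′ → b ∈ js → InB m n p b →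
                    LastLight (loads s b) → Light (load m n p s′ b)
    RemoveB-Light (skipA b∈A r)   (here refl) b∈B last = contradiction b∈A b∈B
    RemoveB-Light (skipA _ r)     (there i)   b∈B last = RemoveB-Light r i b∈B last
    RemoveB-Light {s} {b = b} (skipE _ empty r) (here refl) b∈B last =
      Removal-Light (RemoveB⇒Removal r) (subst Light (sym (cong sumℚ none)) Light-0)
      where
      none : loads s b ≡ []
      none = trans (contents-cong λ i → off {s} λ h → empty (i , h)) (cong (map p) (filterᵇ-false (allFin n)))
    RemoveB-Light (skipE _ _ r)   (there i)   b∈B last = RemoveB-Light r i b∈B last
    RemoveB-Light {s} (remove {i = i} _ (h , max , refl) r) (here refl) b∈B last =
      Removal-Light (RemoveB⇒Removal r) (Light-remove last (loads-unassign s i h) (largest-bound {s} max))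
    RemoveB-Light {s} {b = b} (remove {j = j} {i = i} j∈B (h , max , refl) r) (there b∈) b∈B last = case j Fin.≟ b of λ where
      -- The list may contain b more than once; its first visit settles the claim.
      (yes refl) → Removal-Light (RemoveB⇒Removal r) (Light-remove last (loads-unassign s i h) (largest-bound {s} max))
      (no ne)    → RemoveB-Light r b∈ b∈B (subst LastLight (sym (loads-unassign-other s i h ne)) last)

  -- The reassignment.

  load-over-5/4 : ∀ L x y → (+ 7 / 4) * L < y + x → x ≤ ½ * L → (+ 5 / 4) * L ≤ y
  load-over-5/4 L x y h₁ h₂ =
    linear-≤ (L ∷ x ∷ y ∷ []) ((+ 5 / 4) :* var 0F) (var 2F)
      (add 1ℚ ((+ 7 / 4) :* var 0F) (var 2F :+ var 1F) (<⇒≤ h₁)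
      (add 1ℚ (var 1F) (½ :* var 0F) h₂
      [])) refl

  load-over : ∀ L x y → (+ 7 / 4) * L < y + x → (+ 7 / 4) * L + (- 1ℚ) * x ≤ y
  load-over L x y h₁ =
    linear-≤ (L ∷ x ∷ y ∷ []) ((+ 7 / 4) :* var 0F :+ (- 1ℚ) :* var 1F) (var 2F)
      (add 1ℚ ((+ 7 / 4) :* var 0F) (var 2F :+ var 1F) (<⇒≤ h₁)
      []) refl

  load-over-3/4 : ∀ L x y → (+ 7 / 4) * L < y + x → x ≤ L → (+ 3 / 4) * L < y
  load-over-3/4 L x y h₁ h₂ =
    linear-< (L ∷ x ∷ y ∷ []) ((+ 3 / 4) :* var 0F) (var 2F) 1ℚ ((+ 7 / 4) :* var 0F) (var 2F :+ var 1F) h₁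
      (add 1ℚ (var 1F) (var 0F) h₂
      []) refl

  matched : ∀ L x → 0ℚ ≤ L → L + L ≤ (+ 1 / 4) * L + x + (+ 7 / 4) * L + (- 1ℚ) * x
  matched L x _ =
    linear-≤ (L ∷ x ∷ []) (var 0F :+ var 0F) ((+ 1 / 4) :* var 0F :+ var 1F :+ (+ 7 / 4) :* var 0F :+ (- 1ℚ) :* var 1F)
      [] refl

  slack-small : ∀ L x → 0ℚ ≤ L → 0ℚ < x → L < (+ 5 / 4) * L + x
  slack-small L x h₁ h₂ =
    linear-< (L ∷ x ∷ []) (var 0F) ((+ 5 / 4) :* var 0F :+ var 1F) 1ℚ :0 (var 1F) h₂
      (add (+ 1 / 4) :0 (var 0F) h₁
      []) refl

  -- The terms in x cancel to leave L < 7/4 L, so only L > 0 is at stake, and L/2 < x ≤ L gives it.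
  slack-large : ∀ L x → ½ * L < x → x ≤ L → L < (+ 7 / 4) * L + (- 1ℚ) * x + x
  slack-large L x h₁ h₂ =
    linear-< (L ∷ x ∷ []) (var 0F) ((+ 7 / 4) :* var 0F :+ (- 1ℚ) :* var 1F :+ var 1F) (+ 3 / 2) (½ :* var 0F) (var 1F) h₁
      (add (+ 3 / 2) (var 1F) (var 0F) h₂
      []) refl

  after-A : ∀ L x y → x ≤ L → y ≤ (+ 3 / 4) * L → x + y ≤ (+ 7 / 4) * L
  after-A L x y h₁ h₂ =
    linear-≤ (L ∷ x ∷ y ∷ []) (var 1F :+ var 2F) ((+ 7 / 4) :* var 0F)
      (add 1ℚ (var 1F) (var 0F) h₁
      (add 1ℚ (var 2F) ((+ 3 / 4) :* var 0F) h₂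
      [])) refl

  on-top : ∀ L x s y z → (+ 1 / 4) * L < s → s + z ≤ y → x ≤ z → (+ 1 / 4) * L + x ≤ y
  on-top L x s y z h₁ h₂ h₃ =
    linear-≤ (L ∷ x ∷ s ∷ y ∷ z ∷ []) ((+ 1 / 4) :* var 0F :+ var 1F) (var 3F)
      (add 1ℚ ((+ 1 / 4) :* var 0F) (var 2F) (<⇒≤ h₁)
      (add 1ℚ (var 2F :+ var 4F) (var 3F) h₂
      (add 1ℚ (var 1F) (var 4F) h₃
      []))) refl

  3/4≤7/4 : ∀ L y → y ≤ (+ 3 / 4) * L → 0ℚ ≤ L → y ≤ (+ 7 / 4) * L
  3/4≤7/4 L y h₁ h₂ =
    linear-≤ (L ∷ y ∷ []) (var 1F) ((+ 7 / 4) :* var 0F)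
      (add 1ℚ (var 1F) ((+ 3 / 4) :* var 0F) h₁
      (add 1ℚ :0 (var 0F) h₂
      [])) refl

  5/4≤7/4 : ∀ L y → y ≤ (+ 5 / 4) * L → 0ℚ ≤ L → y ≤ (+ 7 / 4) * L
  5/4≤7/4 L y h₁ h₂ =
    linear-≤ (L ∷ y ∷ []) (var 1F) ((+ 7 / 4) :* var 0F)
      (add 1ℚ (var 1F) ((+ 5 / 4) :* var 0F) h₁
      (add ½ :0 (var 0F) h₂
      [])) refl

  module ReassignPhase (m : ℕ) (1≤m : 1 ℕ.≤ m) (n : ℕ) (p : Fin n → ℚ) (0<p : ∀ i → 0ℚ < p i)
                       (s₂ : State m n p) where
    open Instance m 1≤m n p 0<p
    open States m 1≤m n p 0<p
    open ALG m n p (+ 7 / 4)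

    0≤L : 0ℚ ≤ L
    0≤L = L-nonneg n

    QuarterOnA : Set
    QuarterOnA = ∀ a → InA m n p a → (+ 1 / 4) * L < load m n p s₂ a

    -- Jobs are placed in decreasing order, so a job received during reassignment dominates the waiting ones.
    record Received (s : State m n p) (Rs : List (Fin n)) (j : Fin m) : Set where
      constructor received
      field
        job   : Fin n
        placement : s job ≡ just j
        atop  : load m n p s₂ j + p job ≤ load m n p s j
        first : All (λ k → p k ≤ p job) Rs

    -- A machine without a received job retains what the removal gave: 3/4 L on A, and on B the
    -- explanation of any excess over 3/4 L.
    record Invariant (s : State m n p) (Rs : List (Fin n)) : Set where
      field
        waiting : All (λ i → s i ≡ nothing) Rs
        unique  : Unique Rs
        sorted  : AllPairs (λ i j → p j ≤ p i) Rs
        fits    : ∀ j → load m n p s j ≤ (+ 7 / 4) * L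
        grows   : ∀ j → load m n p s₂ j ≤ load m n p s j
        onA     : ∀ a → InA m n p a → load m n p s a ≤ (+ 3 / 4) * L ⊎ Received s Rs a
        onB     : ∀ b → InB m n p b → ((+ 3 / 4) * L < load m n p s b → QuarterOnA) ⊎ Received s Rs b
    open Invariant

    b₀ : Fin m
    b₀ = Fin.fromℕ< (ℕ.m/n<m m 2 {{ℕ.>-nonZero 1≤m}} (ℕ.s≤s (ℕ.s≤s ℕ.z≤n)))

    b₀∈B : InB m n p b₀
    b₀∈B lt = ℕ.<-irrefl (Fin.toℕ-fromℕ< _) lt

    term≤sum : ∀ (w : Fin n → ℚ) → (∀ i → 0ℚ ≤ w i) → ∀ {xs i} → i ∈ xs → w i ≤ sumℚ (map w xs)
    term≤sum w 0≤w {xs} i∈ = ∈-≤-sumℚ (All.map⁺ (All.universal 0≤w xs)) (∈-map⁺ w i∈)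

    -- As j is least loaded, a load above 3/4 L there means that all of A exceeds 3/4 L, while all
    -- of B exceeds 7/4 L - `p i`. The cases of the contradiction depend on whether `p i` is above
    -- L/2.
    A-has-room : ∀ {s i Rs j} → Invariant s (i ∷ Rs) → (∀ b → InB m n p b → ¬ load m n p s b + p i ≤ (+ 7 / 4) * L) →
                 InA m n p j → (∀ a → InA m n p a → load m n p s j ≤ load m n p s a) → load m n p s j ≤ (+ 3 / 4) * L
    A-has-room {s} {i} {Rs} {j} inv blocked j∈A least = ≮⇒≥ impossible
      where
      -- The partial schedule is completed by putting all unassigned jobs on `b₀`; among them `i` is
      -- the extra load required by `crowded`.
      σ : Fin n → Fin m
      σ k = fromMaybe b₀ (s k)

      s-i : s i ≡ nothing
      s-i = All.head (waiting inv)

      placed : ∀ {l} k → onMachine m n p s l k ≡ true → sameMachine (σ k) l ≡ true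
      placed {l} k on rewrite just-on {s} on = sameMachine-refl l

      placed₀ : ∀ k → onMachine m n p (assign s i b₀) b₀ k ≡ true → sameMachine (σ k) b₀ ≡ true
      placed₀ k on = case k Fin.≟ i of λ where
        (yes refl) → subst (λ x → sameMachine (fromMaybe b₀ x) b₀ ≡ true) (sym s-i) (sameMachine-refl b₀)
        (no k≢i)   → placed k (on-just {s} (trans (sym (assign-other s k≢i)) (just-on {assign s i b₀} on)))

      weigh : ∀ (w : Fin n → ℚ) → (∀ k → 0ℚ ≤ w k) → ∀ l →
              sumℚ (map w (jobs s l)) ≤ sumℚ (map w (filterᵇ (λ k → sameMachine (σ k) l) (allFin n)))
      weigh w 0≤w l = sum-filterᵇ-mono {P = onMachine m n p s l} {w = w} (All.universal 0≤w (allFin n)) (λ k → placed {l} k)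

      weigh₀ : ∀ (w : Fin n → ℚ) → (∀ k → 0ℚ ≤ w k) →
               sumℚ (map w (jobs s b₀)) + w i ≤ sumℚ (map w (filterᵇ (λ k → sameMachine (σ k) b₀) (allFin n)))
      weigh₀ w 0≤w = subst (_≤ sumℚ (map w (filterᵇ (λ k → sameMachine (σ k) b₀) (allFin n))))
        (trans (sumℚ-↭ (map⁺ w (jobs-assign s i b₀ s-i))) (+-comm (w i) _))
        (sum-filterᵇ-mono {P = onMachine m n p (assign s i b₀) b₀} {w = w} (All.universal 0≤w (allFin n)) placed₀)

      over : ∀ b → InB m n p b → (+ 7 / 4) * L < load m n p s b + p i
      over b b∈B = ≰⇒> (blocked b b∈B)

      everything : sumℚ (map p (allFin n)) ≤ m · L
      everything = subst (_≤ m · L) (cong sumℚ firstK-n) (L-average n)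

      pi≤L : p i ≤ L
      pi≤L = p≤L i n (Fin.toℕ<n i)

      impossible : ¬ (+ 3 / 4) * L < load m n p s j
      impossible full = case p i ≤? ½ * L of λ where
          -- B exceeds 7/4 L - L/2 = 5/4 L, which pairs with 3/4 L on A.
          (yes sm) → crowded σ p (allFin n) {(+ 3 / 4) * L} {(+ 5 / 4) * L} {p i} {L} b₀ b₀∈B (0<p i)
            (slack-small L (p i) 0≤L (0<p i)) (small-sum L 0≤L)
            (λ a a∈A → ≤-trans (<⇒≤ (fullA a a∈A)) (weigh p 0≤p a))
            (λ b b∈B → ≤-trans (load-over-5/4 L (p i) (load m n p s b) (over b b∈B) sm) (weigh p 0≤p b))
            (≤-trans (+-monoˡ-≤ (p i) (load-over-5/4 L (p i) (load m n p s b₀) (over b₀ b₀∈B) sm)) (weigh₀ p 0≤p))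
            everything
          (no ¬sm) → too-many (≰⇒> ¬sm)
        where
        fullA : ∀ a → InA m n p a → (+ 3 / 4) * L < load m n p s a
        fullA a a∈A = <-≤-trans full (least a a∈A)

        receivedA : ∀ a → InA m n p a → Received s (i ∷ Rs) a
        receivedA a a∈A = [ (λ le → contradiction le (<⇒≱ (fullA a a∈A))) , id ]′ (onA inv a a∈A)

        not-quarter : ½ * L < p i → ¬ QuarterOnA
        -- A machine of A keeps L/4 and has received a job of size at least `p i`; paired with 7/4 L
        -- - `p i` on B this is exactly 2L.
        not-quarter big quarter = crowded σ p (allFin n) {(+ 1 / 4) * L + p i} {(+ 7 / 4) * L + (- 1ℚ) * p i} {p i} {L}
          b₀ b₀∈B (0<p i) (slack-large L (p i) big pi≤L)
          (subst (L + L ≤_) (+-assoc ((+ 1 / 4) * L + p i) _ _) (matched L (p i) 0≤L))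
          (λ a a∈A → let received k _ atop first = receivedA a a∈A in
            ≤-trans (on-top L (p i) (load m n p s₂ a) (load m n p s a) (p k) (quarter a a∈A) atop (All.head first))
                    (weigh p 0≤p a))
          (λ b b∈B → ≤-trans (load-over L (p i) (load m n p s b) (over b b∈B)) (weigh p 0≤p b))
          (≤-trans (+-monoˡ-≤ (p i) (load-over L (p i) (load m n p s b₀) (over b₀ b₀∈B))) (weigh₀ p 0≤p))
          everything

        too-many : ½ * L < p i → ⊥
        -- With the indicator of size above L/2 as weight, every machine holds at least 1 and `i`
        -- adds another 1, against the total of at most m.
        too-many big = crowded σ w (allFin n) {1ℚ} {1ℚ} {1ℚ} {1ℚ} b₀ b₀∈B 0<1 1<2 ≤-refl
            (λ a _ → ≤-trans (one a) (weigh w 0≤w a)) (λ b _ → ≤-trans (one b) (weigh w 0≤w b))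
            (≤-trans (+-mono-≤ (one b₀) (≤-reflexive (sym (above-1 (½ * L) big)))) (weigh₀ w 0≤w))
            (subst (_≤ m · 1ℚ) (trans (cong (count> (½ * L)) firstK-n) (cong sumℚ (sym (map-∘ (allFin n))))) (few-large n))
          where
          w : Fin n → ℚ
          w k = above (½ * L) (p k)
          0≤w : ∀ k → 0ℚ ≤ w k
          0≤w k = above-nonneg (½ * L) (p k)
          1<2 : 1ℚ < 1ℚ + 1ℚ
          1<2 = subst (_< 1ℚ + 1ℚ) (+-identityˡ 1ℚ) (+-monoˡ-< 1ℚ 0<1)
          receivedAny : ∀ l → Received s (i ∷ Rs) l
          receivedAny l = case toℕ l ℕ.<? m ℕ./ 2 of λ where
            (yes l∈A) → receivedA l l∈A
            -- Since `p i` is at most L, this machine exceeds 3/4 L; had it received nothing,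
            -- `QuarterOnA` would follow.
            (no l∈B)  → [ (λ light → ⊥-elim (not-quarter big
                (light (load-over-3/4 L (p i) (load m n p s l) (over l l∈B) pi≤L)))) , id ]′ (onB inv l l∈B)
          one : ∀ l → 1ℚ ≤ sumℚ (map w (jobs s l))
          one l = let received k on _ first = receivedAny l in
            subst (_≤ sumℚ (map w (jobs s l))) (above-1 (½ * L) (<-≤-trans big (All.head first)))
              (term≤sum w 0≤w (∈-filter⁺ (T? ∘ onMachine m n p s l) (∈-allFin k) (subst T (sym (on-just {s} on)) _)))

    load-assign : ∀ s i j → s i ≡ nothing → load m n p (assign s i j) j ≡ p i + load m n p s j
    load-assign s i j h = sumℚ-↭ (map⁺ p (jobs-assign s i j h))

    load-other : ∀ s i {j} l → s i ≡ nothing → j ≢ l → load m n p (assign s i j) l ≡ load m n p s l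
    load-other s i l h ne = cong sumℚ (loads-assign-other s i h ne)

    Received-next : ∀ {s i Rs j l} → s i ≡ nothing → j ≢ l → Received s (i ∷ Rs) l → Received (assign s i j) Rs l
    Received-next {s} {i} {j = j} {l} h ne (received k on atop first) = received k
      (trans (assign-other s {i} {j} λ { refl → nothing≢just h on }) on)
      (subst (load m n p s₂ l + p k ≤_) (sym (load-other s i l h ne)) atop)
      (All.tail first)

    -- By the sorted order the job just placed dominates all waiting ones. On A it fits because 3/4
    -- L plus a job of at most L is 7/4 L.
    Invariant-next : ∀ {s i Rs j} → Invariant s (i ∷ Rs) → ReassignOK s i j → Invariant (assign s i j) Rs
    Invariant-next {s} {i} {Rs} {j} inv okay with waiting inv | unique inv | sorted inv
    ... | s-i ∷ wait | new ∷ uniq | top ∷ sort = record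
      { waiting = All.zipWith (λ (i≢k , h) → trans (assign-other s (i≢k ∘ sym)) h) (new , wait)
      ; unique  = uniq
      ; sorted  = sort
      ; fits    = λ l → case j Fin.≟ l of λ where
          (yes refl) → subst (_≤ (+ 7 / 4) * L) (sym (load-assign s i j s-i)) (fitting okay)
          (no ne)    → subst (_≤ (+ 7 / 4) * L) (sym (load-other s i l s-i ne)) (fits inv l)
      ; grows   = λ l → case j Fin.≟ l of λ where
          (yes refl) → subst (load m n p s₂ j ≤_) (sym (load-assign s i j s-i))
            (≤-trans (≤-reflexive (sym (+-identityˡ _))) (+-mono-≤ (0≤p i) (grows inv j)))
          (no ne)    → subst (load m n p s₂ l ≤_) (sym (load-other s i l s-i ne)) (grows inv l)
      ; onA     = λ a a∈A → case j Fin.≟ a of λ where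
          (yes refl) → inj₂ newly
          (no ne)    → ⊎-map (subst (_≤ (+ 3 / 4) * L) (sym (load-other s i a s-i ne)))
                             (Received-next s-i ne) (onA inv a a∈A)
      ; onB     = λ b b∈B → case j Fin.≟ b of λ where
          (yes refl) → inj₂ newly
          (no ne)    → ⊎-map (λ h lt → h (subst ((+ 3 / 4) * L <_) (load-other s i b s-i ne) lt))
                             (Received-next s-i ne) (onB inv b b∈B)
      }
      where
      newly : Received (assign s i j) Rs j
      newly = received i (assign-same s i j)
        (subst (load m n p s₂ j + p i ≤_) (trans (+-comm _ (p i)) (sym (load-assign s i j s-i)))
          (+-monoˡ-≤ (p i) (grows inv j)))
        top
      fitting : ReassignOK s i j → p i + load m n p s j ≤ (+ 7 / 4) * L
      fitting (inj₁ (_ , le)) = subst (_≤ (+ 7 / 4) * L) (+-comm _ (p i)) le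
      fitting (inj₂ (blocked , j∈A , least)) = after-A L (p i) (load m n p s j)
        (p≤L i n (Fin.toℕ<n i)) (A-has-room inv blocked j∈A least)

    Reassign-fits : ∀ {s Rs s₃} → Invariant s Rs → Reassign s Rs s₃ → ∀ j → load m n p s₃ j ≤ (+ 7 / 4) * L
    Reassign-fits inv done          = fits inv
    Reassign-fits inv (next okay r) = Reassign-fits (Invariant-next inv okay) r

  -- The number of migrations and the final result.

  -- With h machines in A and d in B, h ≤ d gives 2d + 8h ≤ 5d + 5h = 5m.
  count-migrations : ∀ m {b a} → b ℕ.≤ m ℕ.∸ m ℕ./ 2 → a ℕ.≤ m ℕ./ 2 ℕ.* 4 → 2 ℕ.* (b ℕ.+ a) ℕ.≤ 5 ℕ.* m
  count-migrations m {b} {a} hb ha = begin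
    2 ℕ.* (b ℕ.+ a)                    ≤⟨ ℕ.*-monoʳ-≤ 2 (ℕ.+-mono-≤ hb ha) ⟩
    2 ℕ.* (d ℕ.+ h ℕ.* 4)              ≡⟨ eq₁ d h ⟩
    (2 ℕ.* d ℕ.+ 5 ℕ.* h) ℕ.+ 3 ℕ.* h  ≤⟨ ℕ.+-monoʳ-≤ (2 ℕ.* d ℕ.+ 5 ℕ.* h) (ℕ.*-monoʳ-≤ 3 h≤d) ⟩
    (2 ℕ.* d ℕ.+ 5 ℕ.* h) ℕ.+ 3 ℕ.* d  ≡⟨ eq₂ d h ⟩
    5 ℕ.* (d ℕ.+ h)                    ≡⟨ cong (5 ℕ.*_) (ℕ.m∸n+n≡m (m/2≤m m)) ⟩
    5 ℕ.* m                            ∎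
    where
    open ℕ.≤-Reasoning
    h d : ℕ
    h = m ℕ./ 2
    d = m ℕ.∸ h
    h≤d : h ℕ.≤ d
    h≤d = ℕ.m+n≤o⇒m≤o∸n h (subst (ℕ._≤ m) (trans (ℕ.*-comm h 2) (cong (h ℕ.+_) (ℕ.+-identityʳ h))) (ℕ.m/n*n≤m m 2))
    eq₁ : ∀ d h → 2 ℕ.* (d ℕ.+ h ℕ.* 4) ≡ (2 ℕ.* d ℕ.+ 5 ℕ.* h) ℕ.+ 3 ℕ.* h
    eq₁ = solve-∀
    eq₂ : ∀ d h → (2 ℕ.* d ℕ.+ 5 ℕ.* h) ℕ.+ 3 ℕ.* d ≡ 5 ℕ.* (d ℕ.+ h)
    eq₂ = solve-∀

  ·ℕ≡* : ∀ k x → k ·ℕ x ≡ k ℕ.* x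
  ·ℕ≡* zero    x = refl
  ·ℕ≡* (suc k) x = cong (x ℕ.+_) (·ℕ≡* k x)

  module Result (m : ℕ) (2≤m : 2 ℕ.≤ m) (n : ℕ) (p : Fin n → ℚ) (0<p : ∀ i → 0ℚ < p i)
                (choice : Fin n → Fin m)
                (ok : ∀ t → ALG.Arrival.ArrivalOK m n p (+ 7 / 4) choice t) where
    1≤m : 1 ℕ.≤ m
    1≤m = ℕ.<⇒≤ 2≤m
    open Instance m 1≤m n p 0<p
    open States m 1≤m n p 0<p
    open ArrivalPhase m 1≤m n p 0<p choice ok
    open Migration m 1≤m n p 0<p choice ok
    open ALG m n p (+ 7 / 4)

    module Run {s₁ RB} (removeB : RemoveB (Arrival.arrivalSchedule choice) (allFin m) RB s₁)
               {s₂ RA} (removeA : RemoveA s₁ RA s₂) where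
      open ReassignPhase m 1≤m n p 0<p s₂

      loads-A : ∀ a → InA m n p a → loads s₁ a ≡ H a n
      loads-A a a∈A = trans (RemoveB-loads-A removeB a∈A) (loads-arrival a)

      light-B : ∀ b → InB m n p b → Light (load m n p s₂ b)
      light-B b b∈B = subst Light (sym (cong sumℚ (RemoveA-loads-B removeA b∈B)))
        (RemoveB-Light removeB (∈-allFin b) b∈B (subst LastLight (sym (loads-arrival b)) (LastLight-final b∈B)))

      quarter : SmallOnA → QuarterOnA
      quarter smallOnA a a∈A = <-≤-trans
        (RemoveA-small removeA (subst (λ xs → (+ 1 / 4) * L < sumℚ (filterᵇ (small (½ * L)) xs))
          (sym (loads-A a a∈A)) (smallOnA a a∈A)))
        (small≤all (contents-nonneg (onMachine m n p s₂ a)))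
        where
        small≤all : ∀ {xs} → All (0ℚ ≤_) xs → sumℚ (filterᵇ (small (½ * L)) xs) ≤ sumℚ xs
        small≤all {xs} h = subst (sumℚ (filterᵇ (small (½ * L)) xs) ≤_)
          (cong sumℚ (filterᵇ-true (λ _ → refl) xs)) (sum-filterᵇ-id-mono h λ _ _ → refl)

      removed : All (λ i → s₂ i ≡ nothing) (RB ++ RA) × Unique (RB ++ RA)
      removed = Removal-removes (Removal-++ (RemoveB⇒Removal removeB) (RemoveA⇒Removal removeA))

      initial : ∀ {Rs} → Rs ↭ RB ++ RA → Linked (λ i j → p j ≤ p i) Rs → Invariant s₂ Rs
      initial Rs↭ sorted = record
        { waiting = All-resp-↭ (↭-sym Rs↭) (proj₁ removed)
        ; unique  = Unique-resp-↭ (setoid (Fin n)) (↭⇒↭ₛ (↭-sym Rs↭)) (proj₂ removed)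
        ; sorted  = Linked⇒AllPairs (λ h h′ → ≤-trans h′ h) sorted
        ; fits    = λ j → case toℕ j ℕ.<? m ℕ./ 2 of λ where
            (yes j∈A) → 3/4≤7/4 L (load m n p s₂ j) (RemoveA-final removeA j j∈A) 0≤L
            (no j∈B)  → 5/4≤7/4 L (load m n p s₂ j) (proj₁ (light-B j j∈B)) 0≤L
        ; grows   = λ _ → ≤-refl
        ; onA     = λ a a∈A → inj₁ (RemoveA-final removeA a a∈A)
        ; onB     = λ b b∈B → inj₁ (quarter ∘ proj₂ (light-B b b∈B))
        }

      fromB : length RB ℕ.≤ m ℕ.∸ m ℕ./ 2
      fromB = ℕ.≤-trans (RemoveB-length removeB) (ℕ.≤-reflexive (begin
        sumᴸ (map onlyB (allFin m))           ≡⟨ cong sumᴸ (map-tabulate id onlyB) ⟩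
        sumᴸ (List.tabulate onlyB)            ≡⟨ sum-tabulate onlyB ⟩
        sumℕ onlyB                           ≡⟨ sum-threshold ℕ.+-0-commutativeMonoid m (m ℕ./ 2) 0 1 (m/2≤m m) ⟩
        h ·ℕ 0 ℕ.+ (m ℕ.∸ h) ·ℕ 1            ≡⟨ cong₂ ℕ._+_ (trans (·ℕ≡* h 0) (ℕ.*-zeroʳ h)) (trans (·ℕ≡* (m ℕ.∸ h) 1) (ℕ.*-identityʳ _)) ⟩
        m ℕ.∸ h                              ∎))
        where
        open ≡-Reasoning
        h = m ℕ./ 2

      four : Fin m → ℕ
      four j = if toℕ j ℕ.<ᵇ m ℕ./ 2 then 4 else 0

      fromA : length RA ℕ.≤ m ℕ./ 2 ℕ.* 4
      fromA = ℕ.≤-trans (RemoveA-length removeA four trims) (ℕ.≤-reflexive (begin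
        sumℕ four                            ≡⟨ sum-threshold ℕ.+-0-commutativeMonoid m (m ℕ./ 2) 4 0 (m/2≤m m) ⟩
        h ·ℕ 4 ℕ.+ (m ℕ.∸ h) ·ℕ 0            ≡⟨ cong₂ ℕ._+_ (·ℕ≡* h 4) (trans (·ℕ≡* (m ℕ.∸ h) 0) (ℕ.*-zeroʳ (m ℕ.∸ h))) ⟩
        h ℕ.* 4 ℕ.+ 0                        ≡⟨ ℕ.+-identityʳ _ ⟩
        h ℕ.* 4                              ∎))
        where
        open ≡-Reasoning
        h = m ℕ./ 2
        trims : ∀ a → InA m n p a → Trim (four a) (loads s₁ a) ((+ 3 / 4) * L)
        trims a a∈A = subst₂ (λ k xs → Trim k xs ((+ 3 / 4) * L))
          (sym (cong (if_then 4 else 0) (<ᵇ-true a∈A))) (sym (loads-A a a∈A)) (Balanced.trim₄ (Balanced-final a∈A))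

      -- The final loads are compared with L, and L is below the makespan of any schedule.
      competitive : ∀ {Rs s₃} → Rs ↭ RB ++ RA → Linked (λ i j → p j ≤ p i) Rs → Reassign s₂ Rs s₃ →
                    ∀ σ j → load m n p s₃ j ≤ (+ 7 / 4) * makespan m n p σ
      competitive Rs↭ sorted reassign σ j =
        ≤-trans (Reassign-fits (initial Rs↭ sorted) reassign j) (*-monoˡ-≤-nonNeg (+ 7 / 4) (L≤makespan σ))

      few-migrations : 2 ℕ.* length (RB ++ RA) ℕ.≤ 5 ℕ.* m
      few-migrations = subst (λ k → 2 ℕ.* k ℕ.≤ 5 ℕ.* m) (sym (length-++ RB)) (count-migrations m fromB fromA)

open import Data.Nat using (ℕ; _≤_; _*_)
open import Data.Fin using (Fin)
open import Data.List using (List; _++_; length; allFin)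
open import Data.List.Relation.Binary.Permutation.Propositional using (_↭_)
open import Data.List.Relation.Unary.Linked using (Linked)
open import Data.Integer using (+_)
open import Data.Rational using (ℚ; 0ℚ; _/_) renaming (_≤_ to _≤ℚ_; _<_ to _<ℚ_; _*_ to _*ℚ_)
open import Data.Product using (_×_)
open import Data.Product using (_,_)

-- The optimum enters through all schedules `σ`; ties and the order among equal jobs are arbitrary;
-- 2.5 m is doubled to stay in ℕ.
theorem5 : (m : ℕ) → 2 ≤ m → (n : ℕ) → (p : Fin n → ℚ) → (∀ i → 0ℚ <ℚ p i) →
  let open ALG m n p (+ 7 / 4) in
  (choice : Fin n → Fin m) → (∀ t → Arrival.ArrivalOK choice t) →
  (s₁ : State m n p) (RB : List (Fin n)) → RemoveB (Arrival.arrivalSchedule choice) (allFin m) RB s₁ →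
  (s₂ : State m n p) (RA : List (Fin n)) → RemoveA s₁ RA s₂ →
  (Rs : List (Fin n)) → Rs ↭ (RB ++ RA) → Linked (λ i j → p j ≤ℚ p i) Rs →
  (s₃ : State m n p) → Reassign s₂ Rs s₃ →
  ((σ : Fin n → Fin m) → (j : Fin m) → load m n p s₃ j ≤ℚ ((+ 7 / 4) *ℚ makespan m n p σ))
  × (2 * length (RB ++ RA) ≤ 5 * m)
theorem5 m 2≤m n p 0<p choice ok s₁ RB removeB s₂ RA removeA Rs Rs↭ sorted s₃ reassign =
  competitive Rs↭ sorted reassign , few-migrations
  where
  open Result m 2≤m n p 0<p choice ok
  open Run removeB removeA
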